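{- For every positive integer $n$ there exists a bijection $\Phi : DC(n)\rightarrow DH(n)$ such that $$\omega(\Phi(C)) = q^{\binom{n}{2}-\mathrm{inv}(C)}$$ for all $C\in DC(n)$.
   Context: Dellac configurations. A Dellac configuration of size $n$ is a placement of $2n$ dots in the cells of a grid with $n$ columns (indexed $1,\dots,n$ from left to right) and $2n$ rows (indexed $1,\dots,2n$ from bottom to top) such that each row contains exactly one dot, each column contains exactly two dots, and every dot in column $j$ and row $i$ satisfies $j\le i\le j+n$. $DC(n)$ is the set of these. An inversion of $C$ is a pair of dots with (column,row) coordinates $(j_1,i_1),(j_2,i_2)$, $j_1<j_2$, $i_1>i_2$; $\mathrm{inv}(C)$ is their number. Dyck paths. A Dyck path of length $2n$ is a sequence $\gamma=(p_0,\dots,p_{2n})$ of points of $\mathbb{N}^2$ with $p_0=(0,0)$, $p_{2n}=(2n,0)$, each step $p_i-p_{i-1}$ equal to $(1,1)$ (up step) or $(1,-1)$ (down step). A Dyck path has $n$ down steps; $s^d_i$ denotes the $i$-th down step from the left. For each $j\in[n]$ the point $p_{2j-2}$ has even height. Dellac histories. A Dellac history of length $2n$ is a pair $(\gamma,\xi)$ where $\gamma=(p_0,\dots,p_{2n})$ is a Dyck path of length $2n$ and $\xi=(\xi_1,\dots,\xi_n)$ with $\xi_i=(n_1(i),n_2(i))$ a pair of nonnegative integers, subject to the following: for each $j\in[n]$, let $2k$ be the height of $p_{2j-2}$; (1) if $(p_{2j-2},p_{2j-1})$ is a down step $s^d_i$ and $(p_{2j-1},p_{2j})$ is an up step, then $k\ge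 n_1(i)>n_2(i)\ge 0$, and $s^d_i$ gets weight $\omega_i=q^{2k-n_1(i)-n_2(i)}$; (2) if $(p_{2j-2},p_{2j-1})$ is an up step and $(p_{2j-1},p_{2j})$ is a down step $s^d_i$, then $0\le n_1(i)\le n_2(i)\le k$, and $\omega_i=q^{2k-n_1(i)-n_2(i)}$; (3) if $(p_{2j-2},p_{2j-1})=s^d_i$ and $(p_{2j-1},p_{2j})=s^d_{i+1}$ are both down steps, then $k-1\ge n_1(i)\ge n_2(i)\ge 0$ with $\omega_i=q^{2k-1-n_1(i)-n_2(i)}$, and $0\le n_1(i+1)\le n_2(i+1)\le k-1$ with $\omega_{i+1}=q^{2k-2-n_1(i+1)-n_2(i+1)}$. The weight of the history is $\omega(\gamma,\xi)=\prod_{i=1}^n\omega_i$. $DH(n)$ is the set of Dellac histories of length $2n$. -}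

module Defs where

open import Data.Bool using (Bool; true; false; if_then_else_)
open import Data.Nat using (ℕ; zero; suc; _+_; _*_; _∸_; _≤_; _<_; _≟_; _<ᵇ_; ⌊_/2⌋)
open import Data.Fin using (Fin; toℕ)
open import Data.Vec using (Vec; []; _∷_; lookup; count)
open import Data.List using (List; map; upTo; allFin)
open import Data.Nat.ListAction using (sum)
open import Data.Product using (Σ; _×_; _,_; proj₁; proj₂)
open import Relation.Binary.PropositionalEquality using (_≡_)
import Data.Fin as F

-- Generic helper: safe positional access into a vector by a natural
-- number (0-indexed); returns the default `d` when out of range.
-- (All accesses below are in range for the objects considered.)

at : ∀ {A : Set} {m} → Vec A m → ℕ → A → A
at []       _       d = d
at (x ∷ xs) zero    d = x
at (x ∷ xs) (suc t) d = at xs t d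

-- Dellac configurations.
-- Rows and columns are 0-indexed: row r ∈ {0,…,2n-1} corresponds to the
-- paper's row r+1, column c ∈ {0,…,n-1} to the paper's column c+1.
-- Since each row contains exactly one dot, a placement is a vector
-- assigning to every row the column of its dot.

Placement : ℕ → Set
Placement n = Vec (Fin n) (2 * n)

record IsDellac (n : ℕ) (v : Placement n) : Set where
  field
    twoPerColumn : (c : Fin n) → count (F._≟ c) v ≡ 2
    -- dot in column j, row i satisfies j ≤ i ≤ j + n
    -- (invariant under the common 0-index shift)
    lowerBound : (r : Fin (2 * n)) → toℕ (lookup v r) ≤ toℕ r
    upperBound : (r : Fin (2 * n)) → toℕ r ≤ toℕ (lookup v r) + n

DC : ℕ → Set
DC n = Σ (Placement n) (IsDellac n)

invP : ∀ {n} → Placement n → ℕ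
invP {n} v =
  sum (map (λ r → sum (map (λ r' →
         if (toℕ r <ᵇ toℕ r') then
           (if (toℕ (lookup v r') <ᵇ toℕ (lookup v r)) then 1 else 0)
         else 0)
       (allFin (2 * n))))
     (allFin (2 * n)))

inv : ∀ {n} → DC n → ℕ
inv C = invP (proj₁ C)

-- Dyck paths of length 2n, encoded by their step sequence:
-- true = up step (1,1), false = down step (1,-1).
-- Position t (0-indexed) is the step (p_t, p_{t+1}).

Steps : ℕ → Set
Steps n = Vec Bool (2 * n)

upsBefore : ∀ {m} → Vec Bool m → ℕ → ℕ
upsBefore []           _       = 0
upsBefore (b ∷ bs)     zero    = 0
upsBefore (true ∷ bs)  (suc t) = suc (upsBefore bs t)
upsBefore (false ∷ bs) (suc t) = upsBefore bs t

downsBefore : ∀ {m} → Vec Bool m → ℕ → ℕ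
downsBefore []           _       = 0
downsBefore (b ∷ bs)     zero    = 0
downsBefore (true ∷ bs)  (suc t) = downsBefore bs t
downsBefore (false ∷ bs) (suc t) = suc (downsBefore bs t)

-- height of p_t (meaningful when the path stays in ℕ²)
height : ∀ {m} → Vec Bool m → ℕ → ℕ
height s t = upsBefore s t ∸ downsBefore s t

record IsDyck (n : ℕ) (s : Steps n) : Set where
  field
    nonneg : (t : ℕ) → t ≤ 2 * n → downsBefore s t ≤ upsBefore s t
    ends   : upsBefore s (2 * n) ≡ downsBefore s (2 * n)

-- Dellac histories.
-- ξ is a vector of n pairs (n₁(i), n₂(i)); entry i (0-indexed) belongs to
-- the (i+1)-th down step s^d_{i+1}.  The down-step index of a down step at
-- position t is downsBefore s t (0-indexed).

Xi : ℕ → Set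
Xi n = Vec (ℕ × ℕ) n

HistData : ℕ → Set
HistData n = Steps n × Xi n

-- Conditions for block j (0-indexed; paper's j+1), consisting of the steps
-- (p_{2j},p_{2j+1}) and (p_{2j+1},p_{2j+2}), with 2k = height of p_{2j}.
BlockCond : ∀ {n} → Steps n → Xi n → ℕ → Set
BlockCond s ξ j with at s (2 * j) true | at s (suc (2 * j)) true
... | false | true  =
  let k = ⌊ height s (2 * j) /2⌋
      i = downsBefore s (2 * j)
      x = at ξ i (0 , 0)
  in proj₁ x ≤ k × proj₂ x < proj₁ x
... | true  | false =
  let k = ⌊ height s (2 * j) /2⌋
      i = downsBefore s (suc (2 * j))
      x = at ξ i (0 , 0)
  in proj₁ x ≤ proj₂ x × proj₂ x ≤ k
... | false | false =
  let k = ⌊ height s (2 * j) /2⌋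
      i = downsBefore s (2 * j)
      x = at ξ i (0 , 0)
      y = at ξ (suc i) (0 , 0)
  in (proj₁ x < k × proj₂ x ≤ proj₁ x)
   × (proj₁ y ≤ proj₂ y × proj₂ y < k)
... | true  | true  = Data.Unit.⊤
  where import Data.Unit

blockExp : ∀ {n} → Steps n → Xi n → ℕ → ℕ
blockExp s ξ j with at s (2 * j) true | at s (suc (2 * j)) true
... | false | true  =
  let k = ⌊ height s (2 * j) /2⌋
      x = at ξ (downsBefore s (2 * j)) (0 , 0)
  in 2 * k ∸ proj₁ x ∸ proj₂ x
... | true  | false =
  let k = ⌊ height s (2 * j) /2⌋
      x = at ξ (downsBefore s (suc (2 * j))) (0 , 0)
  in 2 * k ∸ proj₁ x ∸ proj₂ x
... | false | false =
  let k = ⌊ height s (2 * j) /2⌋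
      i = downsBefore s (2 * j)
      x = at ξ i (0 , 0)
      y = at ξ (suc i) (0 , 0)
  in (2 * k ∸ 1 ∸ proj₁ x ∸ proj₂ x) + (2 * k ∸ 2 ∸ proj₁ y ∸ proj₂ y)
... | true  | true  = 0

record IsDellacHistory (n : ℕ) (h : HistData n) : Set where
  field
    dyck   : IsDyck n (proj₁ h)
    blocks : (j : ℕ) → j < n → BlockCond (proj₁ h) (proj₂ h) j

DH : ℕ → Set
DH n = Σ (HistData n) (IsDellacHistory n)

-- ω(γ,ξ) = ∏ ω_i is a monomial q^e; weightExp gives e
-- (every down step lies in exactly one block).
weightExp : ∀ {n} → DH n → ℕ
weightExp {n} H =
  sum (map (blockExp (proj₁ (proj₁ H)) (proj₂ (proj₁ H))) (upTo n))

-- Bijection between two subset types, where elements are compared by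
-- their underlying data (the first components).

IsBijection : ∀ {A B : Set} {P : A → Set} {Q : B → Set} →
              (Σ A P → Σ B Q) → Set
IsBijection {A} {B} {P} {Q} Φ =
  ((x y : Σ A P) → proj₁ (Φ x) ≡ proj₁ (Φ y) → proj₁ x ≡ proj₁ y)
  × ((y : Σ B Q) → Σ (Σ A P) λ x → proj₁ (Φ x) ≡ proj₁ y)

{-# OPTIONS --safe #-}
module Submission where

-- Scan a Dellac configuration column by column. After c columns let k be the number of rows n, …, n + c − 1 whose
-- dot is still to come; it is also the number of dots of columns < c that lie in rows c, …, n − 1. Column c has
-- u ∈ {0, 1, 2} dots in the rows ≥ n, and k changes by 1 − u, so 2k is the height of a Dyck path read two steps at
-- a time (both up, mixed, both down).
-- Read the columns of the upper rows from left to right: column c chooses u of the k + 1 rows that are waiting.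
-- Read those of the lower rows from right to left: column c chooses 2 − u of k + 2 − u rows. Hence for u = 1 we get
-- any two numbers a, b ≤ k, which form one label of the history, a valley when b < a and a peak when a ≤ b. For
-- u = 2 the choice labels the first of two down steps; for u = 0 the choice is put on a stack and labels the
-- second down step of the matching descent.

open import Defs
open import Data.Nat using (ℕ; _+_; _≤_)
open import Data.Nat.Combinatorics using (_C_)
open import Data.Product using (Σ; _×_)
open import Relation.Binary.PropositionalEquality using (_≡_)
open import Data.Bool using (Bool; true; false; if_then_else_)
open import Data.Fin as F using (Fin; toℕ; fromℕ<)
open import Data.Fin.Properties using (toℕ<n; toℕ-injective; toℕ-fromℕ<)
open import Data.List.Base using (List; []; _∷_; length; map; _ʳ++_; applyUpTo; tabulate)
open import Data.List.Properties
  using (∷-injective; ∷-injectiveˡ; ∷-injectiveʳ; length-ʳ++; map-tabulate; map-upTo; tabulate-cong)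
open import Data.List.Relation.Unary.All as All using (All; []; _∷_)
open import Data.Nat
  using (zero; suc; _*_; _∸_; _<_; _<ᵇ_; _≡ᵇ_; _≟_; _≤?_; ⌊_/2⌋; z≤n; z<s; s≤s; s≤s⁻¹)
open import Data.Nat.Combinatorics using (nC1≡n; nCk+nC[k+1]≡[n+1]C[k+1])
open import Data.Nat.ListAction using (sum)
open import Data.Nat.Properties hiding (_≟_; _≤?_)
open import Data.Nat.Tactic.RingSolver using (solve-∀)
open import Data.Product using (∃; ∃₂; _,_; proj₁; proj₂)
open import Data.Unit using (⊤; tt)
open import Data.Vec.Base as V using (Vec; []; _∷_; lookup)
open import Function using (_∘_; id; case_of_)
open import Relation.Binary.PropositionalEquality
  using (_≢_; refl; sym; trans; cong; cong₂; subst; module ≡-Reasoning)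
open import Relation.Nullary using (¬_; does; yes; no; contradiction)

-- Letter counts and pair statistics of words

χ : Bool → ℕ
χ b = if b then 1 else 0

<ᵇ-true : ∀ {a b} → a < b → (a <ᵇ b) ≡ true
<ᵇ-true {zero}  (s≤s _)   = refl
<ᵇ-true {suc _} (s≤s a<b) = <ᵇ-true a<b

<ᵇ-false : ∀ {a b} → b ≤ a → (a <ᵇ b) ≡ false
<ᵇ-false z≤n       = refl
<ᵇ-false (s≤s b≤a) = <ᵇ-false b≤a

≡ᵇ-refl : ∀ c → (c ≡ᵇ c) ≡ true
≡ᵇ-refl zero    = refl
≡ᵇ-refl (suc c) = ≡ᵇ-refl c

≡ᵇ-false : ∀ {x c} → x ≢ c → (x ≡ᵇ c) ≡ false
≡ᵇ-false {zero}  {zero}  x≢c = contradiction refl x≢c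
≡ᵇ-false {zero}  {suc _} _   = refl
≡ᵇ-false {suc _} {zero}  _   = refl
≡ᵇ-false {suc _} {suc _} x≢c = ≡ᵇ-false (x≢c ∘ cong suc)

tally : (ℕ → ℕ) → List ℕ → ℕ
tally f w = sum (map f w)

tally-zero : ∀ {f w} → All (λ x → f x ≡ 0) w → tally f w ≡ 0
tally-zero []       = refl
tally-zero (p ∷ ps) = cong₂ _+_ p (tally-zero ps)

count : ℕ → List ℕ → ℕ
count c = tally (λ x → χ (x ≡ᵇ c))

larger : ℕ → List ℕ → ℕ
larger c = tally (λ x → χ (c <ᵇ x))

smaller : ℕ → List ℕ → ℕ
smaller c = tally (λ x → χ (x <ᵇ c))

count-self : ∀ c w → count c (c ∷ w) ≡ suc (count c w)
count-self c w rewrite ≡ᵇ-refl c = refl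

count-other : ∀ {x c} w → x ≢ c → count c (x ∷ w) ≡ count c w
count-other w x≢c rewrite ≡ᵇ-false x≢c = refl

count-absent : ∀ {c w} → All (_≢ c) w → count c w ≡ 0
count-absent = tally-zero ∘ All.map (cong χ ∘ ≡ᵇ-false)

pairs : (ℕ → ℕ → Bool) → List ℕ → ℕ
pairs R []      = 0
pairs R (x ∷ w) = tally (χ ∘ R x) w + pairs R w

-- The rows below `n` are read from top to bottom, which turns their inversions into coinversions.
inversions coinversions : List ℕ → ℕ
inversions   = pairs (λ x y → y <ᵇ x)
coinversions = pairs _<ᵇ_

-- Inversions between a dot of the lower rows `r` and a dot of the upper rows `h`.
cross : List ℕ → List ℕ → ℕ
cross r h = tally (λ y → larger y r) h

-- Insertion

-- Positions beyond the end append the letter.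
insert : ℕ → ℕ → List ℕ → List ℕ
insert zero    x w       = x ∷ w
insert (suc a) x []      = x ∷ []
insert (suc a) x (y ∷ w) = y ∷ insert a x w

insert₂ : ℕ → ℕ → ℕ → List ℕ → List ℕ
insert₂ a b x w = insert a x (insert b x w)

length-insert : ∀ a x w → length (insert a x w) ≡ suc (length w)
length-insert zero    x w       = refl
length-insert (suc a) x []      = refl
length-insert (suc a) x (y ∷ w) = cong suc (length-insert a x w)

length-insert₂ : ∀ a b x w → length (insert₂ a b x w) ≡ 2 + length w
length-insert₂ a b x w = trans (length-insert a x (insert b x w)) (cong suc (length-insert b x w))

All-insert : ∀ {P : ℕ → Set} a {x w} → P x → All P w → All P (insert a x w)
All-insert zero    px ps       = px ∷ ps
All-insert (suc a) px []       = px ∷ []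
All-insert (suc a) px (p ∷ ps) = p ∷ All-insert a px ps

tally-insert : ∀ f a x w → tally f (insert a x w) ≡ f x + tally f w
tally-insert f zero    x w       = refl
tally-insert f (suc a) x []      = refl
tally-insert f (suc a) x (y ∷ w) = trans (cong (f y +_) (tally-insert f a x w)) (swap (f y) (f x) (tally f w))
  where
  swap : ∀ p q r → p + (q + r) ≡ q + (p + r)
  swap = solve-∀

tally-insert₂ : ∀ f a b x w → tally f (insert₂ a b x w) ≡ f x + (f x + tally f w)
tally-insert₂ f a b x w = trans (tally-insert f a x (insert b x w)) (cong (f x +_) (tally-insert f b x w))

count-insert : ∀ c a w → count c (insert a c w) ≡ suc (count c w)
count-insert c a w = trans (tally-insert _ a c w) (count-self c w)

count-insert₂ : ∀ c a b w → count c (insert₂ a b c w) ≡ 2 + count c w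
count-insert₂ c a b w = trans (count-insert c a (insert b c w)) (cong suc (count-insert c b w))

-- Such a `y` forms an `R`-pair with `c` exactly when it stands in front of `c`.
Before : (ℕ → ℕ → Bool) → ℕ → ℕ → Set
Before R c y = R y c ≡ true × R c y ≡ false

module _ (R : ℕ → ℕ → Bool) {c : ℕ} where

  tally-Before : ∀ {w} → All (Before R c) w → tally (χ ∘ R c) w ≡ 0
  tally-Before = tally-zero ∘ All.map (cong χ ∘ proj₂)

  -- The new letter pairs exactly with the `a` letters in front of it; `a ≤ length w` rules out
  -- positions that are cut off at the end.
  pairs-insert : ∀ a {w} → All (Before R c) w → a ≤ length w →
                 pairs R (insert a c w) ≡ a + pairs R w
  pairs-insert zero    ps _ rewrite tally-Before ps = refl
  pairs-insert (suc a) {y ∷ w} ((p , _) ∷ ps) (s≤s a≤)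
    rewrite tally-insert (χ ∘ R y) a c w | p | pairs-insert a ps a≤ = eq (tally (χ ∘ R y) w) a (pairs R w)
    where
    eq : ∀ t a q → suc (t + (a + q)) ≡ suc (a + (t + q))
    eq = solve-∀

  -- The later copy of `c` has `b` old letters and the other copy in front of it, and the two copies
  -- do not pair with each other.
  pairs-insert₂ : ∀ a b {w} → R c c ≡ false → All (Before R c) w → a ≤ b → b ≤ length w →
                  pairs R (insert₂ a b c w) ≡ a + b + pairs R w
  pairs-insert₂ zero b {w} cc ps _ b≤
    rewrite tally-insert (χ ∘ R c) b c w | cc | tally-Before ps = pairs-insert b ps b≤
  pairs-insert₂ (suc a) (suc b) {y ∷ w} cc ((p , _) ∷ ps) (s≤s a≤b) (s≤s b≤)
    rewrite tally-insert₂ (χ ∘ R y) a b c w | p | pairs-insert₂ a b cc ps a≤b b≤ = eq (tally (χ ∘ R y) w) a b (pairs R w)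
    where
    eq : ∀ t a b q → suc (suc (t + (a + b + q))) ≡ suc (a + suc b + (t + q))
    eq = solve-∀

-- Since `w` has no letter `c`, the only `c` of the result marks the position `a`, and deleting it
-- gives `w` back.
insert-injective : ∀ {c} a a′ {w w′} → All (_≢ c) w → All (_≢ c) w′ → a ≤ length w → a′ ≤ length w′ →
                   insert a c w ≡ insert a′ c w′ → a ≡ a′ × w ≡ w′
insert-injective zero zero _ _ _ _ e = refl , ∷-injectiveʳ e
insert-injective zero (suc a′) _ (p ∷ _) _ (s≤s _) e = contradiction (sym (∷-injectiveˡ e)) p
insert-injective (suc a) zero (p ∷ _) _ (s≤s _) _ e = contradiction (∷-injectiveˡ e) p
insert-injective (suc a) (suc a′) (_ ∷ ps) (_ ∷ ps′) (s≤s l) (s≤s l′) e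
  with refl , e′ ← ∷-injective e
  with refl , refl ← insert-injective a a′ ps ps′ l l′ e′ = refl , refl

insert₂-injective : ∀ {c} a b a′ b′ {w w′} → All (_≢ c) w → All (_≢ c) w′ →
                    a ≤ b → a′ ≤ b′ → b ≤ length w → b′ ≤ length w′ →
                    insert₂ a b c w ≡ insert₂ a′ b′ c w′ → a ≡ a′ × b ≡ b′ × w ≡ w′
insert₂-injective zero b zero b′ ps ps′ _ _ l l′ e
  with refl , refl ← insert-injective b b′ ps ps′ l l′ (∷-injectiveʳ e) = refl , refl , refl
insert₂-injective zero b (suc a′) (suc b′) _ (p ∷ _) _ _ _ (s≤s _) e = contradiction (sym (∷-injectiveˡ e)) p
insert₂-injective (suc a) (suc b) zero b′ (p ∷ _) _ _ _ (s≤s _) _ e = contradiction (∷-injectiveˡ e) p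
insert₂-injective (suc a) (suc b) (suc a′) (suc b′) (_ ∷ ps) (_ ∷ ps′) (s≤s o) (s≤s o′) (s≤s l) (s≤s l′) e
  with refl , e′ ← ∷-injective e
  with refl , refl , refl ← insert₂-injective a b a′ b′ ps ps′ o o′ l l′ e′ = refl , refl , refl

-- Staircases

-- The first K letters satisfy P 0, the following ones P 1, P 2, ….
Stair : (ℕ → ℕ → Set) → ℕ → List ℕ → Set
Stair P K       []      = ⊤
Stair P zero    (x ∷ w) = P 1 x × Stair (P ∘ suc) zero w
Stair P (suc K) (x ∷ w) = P 0 x × Stair P K w

stair-map : ∀ {P Q : ℕ → ℕ → Set} → (∀ i {x} → P i x → Q i x) → ∀ K w → Stair P K w → Stair Q K w
stair-map f K       []      _       = tt
stair-map f zero    (x ∷ w) (p , s) = f 1 p , stair-map (f ∘ suc) zero w s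
stair-map f (suc K) (x ∷ w) (p , s) = f 0 p , stair-map f K w s

module _ {P : ℕ → ℕ → Set} where

  -- The letters behind the new one move by one place, and so does the end of the flat part (the
  -- first `K` letters), so every old letter keeps its level. The new letter falls into the flat
  -- part because `a ≤ K`.
  stair-insert : ∀ {c a K w} → P 0 c → a ≤ K → Stair P K w → Stair P (suc K) (insert a c w)
  stair-insert p z≤n s = p , s
  stair-insert {w = []} p (s≤s _) _ = p , tt
  stair-insert {w = _ ∷ _} p (s≤s a≤K) (q , s) = q , stair-insert p a≤K s

  -- The letters after the first `K` face the same conditions on both sides; only the first `K` are
  -- relaxed, from `P 1` to `P 0`.
  stair-weaken : (∀ {x} → P 1 x → P 0 x) → ∀ {K w} → Stair (P ∘ suc) (suc K) w → Stair P K w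
  stair-weaken f {w = []} _ = tt
  stair-weaken f {zero} {_ ∷ _} s = s
  stair-weaken f {suc K} {_ ∷ _} (p , s) = f p , stair-weaken f {K} s

  -- Undoes `stair-weaken`: only the letter `c` could satisfy `P 0` without `P 1`, and it does not
  -- occur.
  stair-strict : ∀ {c} → (∀ {x} → x ≢ c → P 0 x → P 1 x) →
                 ∀ {K} w → count c w ≡ 0 → Stair P K w → Stair (P ∘ suc) (suc K) w
  stair-strict f [] _ _ = tt
  stair-strict f {zero} (_ ∷ _) _ s = s
  stair-strict {c} f {suc K} (x ∷ w) e (p , s) with x ≟ c
  ... | yes refl = contradiction (trans (sym e) (count-self c w)) λ ()
  ... | no x≢c = f x≢c p , stair-strict f w (trans (sym (count-other w x≢c)) e) s

stair-insert₂ : ∀ {P : ℕ → ℕ → Set} {c a b K w} → P 0 c → a ≤ b → b ≤ K → Stair P K w → Stair P (2 + K) (insert₂ a b c w)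
stair-insert₂ p a≤b b≤K s = stair-insert p (m≤n⇒m≤1+n (≤-trans a≤b b≤K)) (stair-insert p b≤K s)

stair-absent : ∀ {P : ℕ → ℕ → Set} {c} → (∀ i → ¬ P (suc i) c) → ∀ w → Stair P zero w → count c w ≡ 0
stair-absent ¬p []      _       = refl
stair-absent {c = c} ¬p (x ∷ w) (p , s) with x ≟ c
... | yes refl = contradiction p (¬p 0)
... | no x≢c   = trans (count-other w x≢c) (stair-absent (¬p ∘ suc) w s)

-- No level above 0 admits `c`, so `c` stands in the flat part. This forces `K` to be positive and
-- bounds the position.
stair-extract : ∀ {P : ℕ → ℕ → Set} {c} → (∀ i → ¬ P (suc i) c) → ∀ K w → Stair P K w → count c w ≡ 1 →
                ∃ λ K′ → ∃₂ λ a w′ → K ≡ suc K′ × a ≤ K′ × Stair P K′ w′ × count c w′ ≡ 0 × w ≡ insert a c w′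
stair-extract ¬p zero w s e = contradiction (trans (sym e) (stair-absent ¬p w s)) λ ()
stair-extract {c = c} ¬p (suc K) (x ∷ w) (p , s) e with x ≟ c
... | yes refl = K , 0 , w , refl , z≤n , s , suc-injective (trans (sym (count-self c w)) e) , refl
... | no x≢c
  with K′ , a , w′ , refl , a≤ , s′ , e′ , refl ← stair-extract ¬p K w s (trans (sym (count-other w x≢c)) e)
  = suc K′ , suc a , x ∷ w′ , refl , s≤s a≤ , (p , s′) , trans (count-other w′ x≢c) e′ , refl

-- Behind the first copy a single `c` is left for `stair-extract`. Its position `b` ignores the
-- first copy, whence `a ≤ b` instead of a strict inequality.
stair-extract₂ : ∀ {P : ℕ → ℕ → Set} {c} → (∀ i → ¬ P (suc i) c) → ∀ K w → Stair P K w → count c w ≡ 2 →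
                 ∃₂ λ K′ a → ∃₂ λ b w′ → K ≡ 2 + K′ × a ≤ b × b ≤ K′ × Stair P K′ w′ × count c w′ ≡ 0 × w ≡ insert₂ a b c w′
stair-extract₂ ¬p zero w s e = contradiction (trans (sym e) (stair-absent ¬p w s)) λ ()
stair-extract₂ {c = c} ¬p (suc K) (x ∷ w) (p , s) e with x ≟ c
... | yes refl
  with K′ , b , w′ , refl , b≤ , s′ , e′ , refl ← stair-extract ¬p K w s (suc-injective (trans (sym (count-self c w)) e))
  = K′ , 0 , b , w′ , refl , z≤n , b≤ , s′ , e′ , refl
... | no x≢c
  with K′ , a , b , w′ , refl , a≤b , b≤ , s′ , e′ , refl ← stair-extract₂ ¬p K w s (trans (sym (count-other w x≢c)) e)
  = suc K′ , suc a , suc b , x ∷ w′ , refl , s≤s a≤b , s≤s b≤ , (p , s′) , trans (count-other w′ x≢c) e′ , refl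

-- Labelled Motzkin paths

-- A pair of positions small < large + 1, stored with the second one decreased by 1.
record Choice (k : ℕ) : Set where
  constructor choice
  field
    small large : ℕ
    ordered     : small ≤ large
    bounded     : large ≤ k

open Choice

choice-≡ : ∀ {k} {p q : Choice k} → small p ≡ small q → large p ≡ large q → p ≡ q
choice-≡ {p = choice _ _ o b} {choice _ _ o′ b′} refl refl = cong₂ (choice _ _) (≤-irrelevant o o′) (≤-irrelevant b b′)

-- Path k m runs from height k to height 0 in m steps; a height k here is the height 2k of the Dyck path.
data Path : ℕ → ℕ → Set where
  done  : Path 0 0
  up    : ∀ {k m} → Choice k → Path (suc k) m → Path k (suc m)
  level : ∀ {k m} a b → a ≤ k → b ≤ k → Path k m → Path k (suc m)
  down  : ∀ {k m} → Choice k → Path k m → Path (suc k) (suc m)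

level-≡ : ∀ {k m a b a′ b′ p q p′ q′} {l l′ : Path k m} → a ≡ a′ → b ≡ b′ → l ≡ l′ → level a b p q l ≡ level a′ b′ p′ q′ l′
level-≡ {p = p} {q} {p′} {q′} refl refl refl = cong₂ (λ p q → level _ _ p q _) (≤-irrelevant p p′) (≤-irrelevant q q′)

insertPair : ∀ {k} → Choice k → ℕ → List ℕ → List ℕ
insertPair p = insert₂ (small p) (large p)

-- upper c l consists of the letters (columns) ≥ c of the rows n, …, 2n − 1, from bottom to top; lower c l w is the
-- whole word of the rows n − 1, …, 0, from top to bottom, w being its subword of the letters < c.
upper : ∀ {k m} → ℕ → Path k m → List ℕ
upper c done              = []
upper c (up p l)          = upper (suc c) l
upper c (level a b _ _ l) = insert a c (upper (suc c) l)
upper c (down p l)        = insertPair p c (upper (suc c) l)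

lower : ∀ {k m} → ℕ → Path k m → List ℕ → List ℕ
lower c done w              = w
lower c (up p l) w          = lower (suc c) l (insertPair p c w)
lower c (level a b _ _ l) w = lower (suc c) l (insert b c w)
lower c (down p l) w        = lower (suc c) l w

-- There are `k` waiting rows, and `m` more rows are still to come.
length-upper : ∀ {k m} c (l : Path k m) → length (upper c l) ≡ k + m
length-upper c done = refl
length-upper c (up {k} {m} p l) = trans (length-upper (suc c) l) (sym (+-suc k m))
length-upper c (level {k} {m} a b _ _ l) =
  trans (length-insert a c _) (trans (cong suc (length-upper (suc c) l)) (sym (+-suc k m)))
length-upper c (down {k} {m} p l) =
  trans (length-insert₂ (small p) (large p) c _) (cong suc (trans (cong suc (length-upper (suc c) l)) (sym (+-suc k m))))

upper-≥ : ∀ {k m} c (l : Path k m) → All (c ≤_) (upper c l)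
upper-≥ c done              = []
upper-≥ c (up p l)          = All.map <⇒≤ (upper-≥ (suc c) l)
upper-≥ c (level a b _ _ l) = All-insert a ≤-refl (All.map <⇒≤ (upper-≥ (suc c) l))
upper-≥ c (down p l)        = All-insert (small p) ≤-refl (All-insert (large p) ≤-refl (All.map <⇒≤ (upper-≥ (suc c) l)))

upper-≢ : ∀ {k m} c (l : Path k m) → All (_≢ c) (upper (suc c) l)
upper-≢ c l = All.map >⇒≢ (upper-≥ (suc c) l)

All-insert⁻ : ∀ {P : ℕ → Set} a {x} w → All P (insert a x w) → All P w
All-insert⁻ zero    w       (_ ∷ ps) = ps
All-insert⁻ (suc a) []      ps       = []
All-insert⁻ (suc a) (y ∷ w) (p ∷ ps) = p ∷ All-insert⁻ a w ps

upper-< : ∀ {k m} c (l : Path k m) → All (_< c + m) (upper c l)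
upper-< c done = []
upper-< c (up {m = m} p l) rewrite +-suc c m = upper-< (suc c) l
upper-< c (level {m = m} a b _ _ l) =
  All-insert a (m<m+n c z<s) (subst (λ n → All (_< n) (upper (suc c) l)) (sym (+-suc c m)) (upper-< (suc c) l))
upper-< c (down {m = m} p l) =
  All-insert (small p) (m<m+n c z<s) (All-insert (large p) (m<m+n c z<s)
    (subst (λ n → All (_< n) (upper (suc c) l)) (sym (+-suc c m)) (upper-< (suc c) l)))

-- All letters that `lower` adds to `w` are at least `c`, where `f` vanishes.
tally-lower : ∀ f {k m} c (l : Path k m) w → (∀ {x} → c ≤ x → f x ≡ 0) → tally f (lower c l w) ≡ tally f w
tally-lower f c done w z = refl
tally-lower f c (up p l) w z =
  trans (tally-lower f (suc c) l _ (z ∘ <⇒≤)) (trans (tally-insert₂ f (small p) (large p) c w)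
    (cong₂ (λ s t → s + (t + tally f w)) (z ≤-refl) (z ≤-refl)))
tally-lower f c (level a b _ _ l) w z =
  trans (tally-lower f (suc c) l _ (z ∘ <⇒≤)) (trans (tally-insert f b c w) (cong (_+ tally f w) (z ≤-refl)))
tally-lower f c (down p l) w z = tally-lower f (suc c) l w (z ∘ <⇒≤)

count-lower : ∀ {k m d} c (l : Path k m) w → d < c → count d (lower c l w) ≡ count d w
count-lower c l w d<c = tally-lower _ c l w (λ c≤x → cong χ (≡ᵇ-false (>⇒≢ (<-≤-trans d<c c≤x))))

-- Every added letter exceeds `d`. A step adds 2, 1 or 0 letters, that is 1 plus the change of
-- height, and the `m` steps lead from height `k` to 0.
larger-lower : ∀ {k m d} c (l : Path k m) w → d < c → larger d (lower c l w) + k ≡ larger d w + m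
larger-lower c done w _ = refl
larger-lower {d = d} c (up {k} {m} p l) w d<c = suc-injective (trans (sym (+-suc _ k))
  (trans (larger-lower (suc c) l _ (m≤n⇒m≤1+n d<c))
  (trans (cong (_+ m) (tally-insert₂ _ (small p) (large p) c w)) eq)))
  where
  eq : χ (d <ᵇ c) + (χ (d <ᵇ c) + larger d w) + m ≡ suc (larger d w + suc m)
  eq rewrite <ᵇ-true d<c = cong suc (sym (+-suc _ m))
larger-lower {d = d} c (level {m = m} a b _ _ l) w d<c =
  trans (larger-lower (suc c) l _ (m≤n⇒m≤1+n d<c)) (trans (cong (_+ m) (tally-insert _ b c w)) eq)
  where
  eq : χ (d <ᵇ c) + larger d w + m ≡ larger d w + suc m
  eq rewrite <ᵇ-true d<c = sym (+-suc _ m)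
larger-lower {d = d} c (down {k} {m} p l) w d<c =
  trans (+-suc _ k) (trans (cong suc (larger-lower (suc c) l w (m≤n⇒m≤1+n d<c))) (sym (+-suc _ m)))

<-+-suc : ∀ {x} c m → x < suc c + m → x < c + suc m
<-+-suc c m x< = ≤-trans x< (≤-reflexive (sym (+-suc c m)))

lower-All : ∀ {P : ℕ → Set} {k m} c (l : Path k m) w → (∀ {x} → c ≤ x → x < c + m → P x) →
            All P w → All P (lower c l w)
lower-All c done w f ps = ps
lower-All c (up {m = m} p l) w f ps = lower-All (suc c) l _ (λ c<x → f (<⇒≤ c<x) ∘ <-+-suc c m)
  (All-insert (small p) (f ≤-refl (m<m+n c z<s)) (All-insert (large p) (f ≤-refl (m<m+n c z<s)) ps))
lower-All c (level {m = m} a b _ _ l) w f ps = lower-All (suc c) l _ (λ c<x → f (<⇒≤ c<x) ∘ <-+-suc c m)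
  (All-insert b (f ≤-refl (m<m+n c z<s)) ps)
lower-All c (down {m = m} p l) w f ps = lower-All (suc c) l w (λ c<x → f (<⇒≤ c<x) ∘ <-+-suc c m) ps

length-lower : ∀ {k m} c (l : Path k m) w → length (lower c l w) + k ≡ length w + m
length-lower c done w = refl
length-lower c (up {k} {m} p l) w = suc-injective (trans (sym (+-suc _ k))
  (trans (length-lower (suc c) l _) (trans (cong (_+ m) (length-insert₂ (small p) (large p) c w)) (cong suc (sym (+-suc _ m))))))
length-lower c (level {m = m} a b _ _ l) w =
  trans (length-lower (suc c) l _) (trans (cong (_+ m) (length-insert b c w)) (sym (+-suc _ m)))
length-lower c (down {k} {m} p l) w =
  trans (+-suc _ k) (trans (cong suc (length-lower (suc c) l w)) (sym (+-suc _ m)))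

-- Staircase bounds for the upper and the lower rows

-- `Stair (Above c) (suc k)` bounds the upper word without its letters below `c`: the `k` waiting
-- rows and row `n + c` admit all columns from `c` on, and each further row excludes one more
-- column. `Below c` does the same for the letters below `c` in the lower word, read downwards.
Above Below : ℕ → ℕ → ℕ → Set
Above c i x = c + i ≤ x
Below c i x = i + x < c

above-weaken : ∀ {c K w} → Stair (Above (suc c)) (suc K) w → Stair (Above c) K w
above-weaken {c} {K} {w} s = stair-weaken (λ {x} c+1≤x → ≤-trans (+-monoʳ-≤ c z≤n) c+1≤x)
  (stair-map (λ i → ≤-trans (≤-reflexive (+-suc c i))) (suc K) w s)

-- The passage to the next column: once `c` is gone, `c ≤ x` sharpens to `c < x`, and one more row
-- joins the flat part.
above-strict : ∀ {c K w} → count c w ≡ 0 → Stair (Above c) K w → Stair (Above (suc c)) (suc K) w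
above-strict {c} {K} {w} e s = stair-map (λ i → ≤-trans (≤-reflexive (sym (+-suc c i)))) (suc K) w
  (stair-strict (λ x≢c c≤x → ≤-trans (≤-reflexive (+-suc c 0)) (≤∧≢⇒< c≤x (λ e → x≢c (trans (sym e) (+-identityʳ c))))) w e s)

below-weaken : ∀ {c K w} → Stair (Below c) (suc K) w → Stair (Below (suc c)) K w
below-weaken {c} {K} {w} s = stair-weaken (m≤n⇒m≤1+n ∘ s≤s⁻¹) (stair-map (λ i → s≤s) (suc K) w s)

below-strict : ∀ {c K w} → count c w ≡ 0 → Stair (Below (suc c)) K w → Stair (Below c) (suc K) w
below-strict {c} {K} {w} e s = stair-map (λ i → s≤s⁻¹) (suc K) w
  (stair-strict (λ x≢c x≤c → s≤s (≤∧≢⇒< (s≤s⁻¹ x≤c) x≢c)) w e s)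

-- `above-weaken` leaves a flat part as long as the height after the step; the 0, 1 or 2 inserted
-- copies of `c` extend it to the height before the step plus 1.
upper-stair : ∀ {k m} c (l : Path k m) → Stair (Above c) (suc k) (upper c l)
upper-stair c done = tt
upper-stair c (up p l) = above-weaken (upper-stair (suc c) l)
upper-stair c (level a b a≤k _ l) = stair-insert (≤-reflexive (+-identityʳ c)) a≤k (above-weaken (upper-stair (suc c) l))
upper-stair c (down p l) =
  stair-insert₂ (≤-reflexive (+-identityʳ c)) (ordered p) (bounded p) (above-weaken (upper-stair (suc c) l))

lower-stair : ∀ {k m} c (l : Path k m) w → Stair (Below c) (suc k) w → Stair (Below (c + m)) 1 (lower c l w)
lower-stair c done w s rewrite +-identityʳ c = s
lower-stair c (up {m = m} p l) w s rewrite +-suc c m =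
  lower-stair (suc c) l _ (stair-insert₂ ≤-refl (ordered p) (bounded p) (below-weaken {w = w} s))
lower-stair c (level {m = m} a b _ b≤k l) w s rewrite +-suc c m =
  lower-stair (suc c) l _ (stair-insert ≤-refl b≤k (below-weaken {w = w} s))
lower-stair c (down {m = m} p l) w s rewrite +-suc c m = lower-stair (suc c) l w (below-weaken {w = w} s)

-- Number of dots in a column

count-insert-other : ∀ {c d} a w → c ≢ d → count d (insert a c w) ≡ count d w
count-insert-other {c} {d} a w c≢d = trans (tally-insert _ a c w) (count-other w c≢d)

count-insert₂-other : ∀ {c d} a b w → c ≢ d → count d (insert₂ a b c w) ≡ count d w
count-insert₂-other {c} a b w c≢d = trans (count-insert-other a (insert b c w) c≢d) (count-insert-other b w c≢d)

-- The number of dots of the first column in the upper rows, which tells the three kinds of steps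
-- apart.
dots : ∀ {k m} → Path k m → ℕ
dots done                = 0
dots (up _ _)            = 0
dots (level _ _ _ _ _)   = 1
dots (down _ _)          = 2

count-upper : ∀ {k m} c (l : Path k m) → count c (upper c l) ≡ dots l
count-upper c done              = refl
count-upper c (up p l)          = count-absent (upper-≢ c l)
count-upper c (level a b _ _ l) = trans (count-insert c a _) (cong suc (count-absent (upper-≢ c l)))
count-upper c (down p l)        = trans (count-insert₂ c (small p) (large p) _) (cong (2 +_) (count-absent (upper-≢ c l)))

upper≡⇒dots≡ : ∀ {k m k′ m′} c (l : Path k m) (l′ : Path k′ m′) → upper c l ≡ upper c l′ → dots l ≡ dots l′
upper≡⇒dots≡ c l l′ e = trans (sym (count-upper c l)) (trans (cong (count c) e) (count-upper c l′))

-- Column `d` gets both its letters at its own step, divided between the two words; the steps of the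
-- other columns leave its count unchanged.
count-word : ∀ {k m d} c (l : Path k m) w → All (_< c) w → c ≤ d → d < c + m →
             count d (upper c l) + count d (lower c l w) ≡ 2
count-word {d = d} c l w ps c≤d d< with c ≟ d
count-word c done w ps c≤d d< | yes refl = contradiction (+-identityʳ c) (>⇒≢ d<)
count-word c (up p l) w ps c≤d d< | yes refl = cong₂ _+_ (count-absent (upper-≢ c l))
  (trans (count-lower (suc c) l _ ≤-refl)
    (trans (count-insert₂ c (small p) (large p) w) (cong (2 +_) (count-absent (All.map <⇒≢ ps)))))
count-word c (level a b _ _ l) w ps c≤d d< | yes refl = cong₂ _+_
  (trans (count-insert c a _) (cong suc (count-absent (upper-≢ c l))))
  (trans (count-lower (suc c) l _ ≤-refl) (trans (count-insert c b w) (cong suc (count-absent (All.map <⇒≢ ps)))))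
count-word c (down p l) w ps c≤d d< | yes refl = cong₂ _+_
  (trans (count-insert₂ c (small p) (large p) _) (cong (2 +_) (count-absent (upper-≢ c l))))
  (trans (count-lower (suc c) l w ≤-refl) (count-absent (All.map <⇒≢ ps)))
count-word c done w ps c≤d d< | no c≢d = contradiction (≤∧≢⇒< c≤d c≢d)
  (≤⇒≯ (s≤s⁻¹ (≤-trans (m≤n⇒m≤1+n d<) (≤-reflexive (cong suc (+-identityʳ c))))))
count-word c (up {m = m} p l) w ps c≤d d< | no c≢d =
  count-word (suc c) l _ (All-insert (small p) ≤-refl (All-insert (large p) ≤-refl (All.map m≤n⇒m≤1+n ps)))
    (≤∧≢⇒< c≤d c≢d) (≤-trans d< (≤-reflexive (+-suc c m)))
count-word c (level {m = m} a b _ _ l) w ps c≤d d< | no c≢d =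
  trans (cong (_+ _) (count-insert-other a _ c≢d))
    (count-word (suc c) l _ (All-insert b ≤-refl (All.map m≤n⇒m≤1+n ps)) (≤∧≢⇒< c≤d c≢d) (≤-trans d< (≤-reflexive (+-suc c m))))
count-word c (down {m = m} p l) w ps c≤d d< | no c≢d =
  trans (cong (_+ _) (count-insert₂-other (small p) (large p) _ c≢d))
    (count-word (suc c) l w (All.map m≤n⇒m≤1+n ps) (≤∧≢⇒< c≤d c≢d) (≤-trans d< (≤-reflexive (+-suc c m))))

-- The two words determine the path

room : ∀ {N} c {k} → N ≡ c + k → k ≤ N
room c refl = m≤n+m _ c

upper-room : ∀ {k m} c (l : Path k m) → k ≤ length (upper c l)
upper-room {k} {m} c l = subst (k ≤_) (sym (length-upper c l)) (m≤m+n k m)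

insertPair-< : ∀ {c k} (p : Choice k) {w} → All (_< c) w → All (_< suc c) (insertPair p c w)
insertPair-< p ps = All-insert (small p) ≤-refl (All-insert (large p) ≤-refl (All.map m≤n⇒m≤1+n ps))

length-insertPair : ∀ {c k} (p : Choice k) w → length w ≡ c + k → length (insertPair p c w) ≡ suc c + suc k
length-insertPair {c} {k} p w n = trans (length-insert₂ (small p) (large p) c w) (cong suc (trans (cong suc n) (sym (+-suc c k))))

-- In the upper word `c` was inserted last, so it is removed before the recursive call. In the lower
-- word the larger letters came after it, so its positions are compared only after the recursive
-- call has identified the subwords of letters up to `c`.
word-injective : ∀ {k m} c (l l′ : Path k m) {w w′} → All (_< c) w → All (_< c) w′ → length w ≡ c + k → length w′ ≡ c + k →
                 upper c l ≡ upper c l′ → lower c l w ≡ lower c l′ w′ → l ≡ l′ × w ≡ w′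
word-injective c done done ps ps′ n n′ eu el = refl , el
word-injective c (up {k} p l) (up p′ l′) {w} {w′} ps ps′ n n′ eu el
  with refl , e ← word-injective (suc c) l l′ (insertPair-< p ps) (insertPair-< p′ ps′)
         (length-insertPair p w n) (length-insertPair p′ w′ n′) eu el
  with e₁ , e₂ , refl ← insert₂-injective (small p) (large p) (small p′) (large p′) (All.map <⇒≢ ps) (All.map <⇒≢ ps′)
         (ordered p) (ordered p′) (≤-trans (bounded p) (room c n)) (≤-trans (bounded p′) (room c n′)) e
  with refl ← choice-≡ {p = p} {p′} e₁ e₂ = refl , refl
word-injective c (level {k} {m} a b a≤ b≤ l) (level a′ b′ a′≤ b′≤ l′) {w} {w′} ps ps′ n n′ eu el
  with refl , eu′ ← insert-injective a a′ (upper-≢ c l) (upper-≢ c l′)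
         (≤-trans a≤ (upper-room (suc c) l))
         (≤-trans a′≤ (upper-room (suc c) l′)) eu
  with refl , e ← word-injective (suc c) l l′ (All-insert b ≤-refl (All.map m≤n⇒m≤1+n ps)) (All-insert b′ ≤-refl (All.map m≤n⇒m≤1+n ps′))
         (trans (length-insert b c w) (cong suc n)) (trans (length-insert b′ c w′) (cong suc n′)) eu′ el
  with refl , refl ← insert-injective b b′ (All.map <⇒≢ ps) (All.map <⇒≢ ps′)
         (≤-trans b≤ (room c n)) (≤-trans b′≤ (room c n′)) e
  = level-≡ refl refl refl , refl
word-injective c (down {k} {m} p l) (down p′ l′) {w} {w′} ps ps′ n n′ eu el
  with e₁ , e₂ , eu′ ← insert₂-injective (small p) (large p) (small p′) (large p′) (upper-≢ c l) (upper-≢ c l′)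
         (ordered p) (ordered p′)
         (≤-trans (bounded p) (upper-room (suc c) l))
         (≤-trans (bounded p′) (upper-room (suc c) l′)) eu
  with refl ← choice-≡ {p = p} {p′} e₁ e₂
  with refl , e ← word-injective (suc c) l l′ (All.map m≤n⇒m≤1+n ps) (All.map m≤n⇒m≤1+n ps′)
         (trans n (+-suc c k)) (trans n′ (+-suc c k)) eu′ el
  = refl , e
word-injective c l@(up _ _)          l′@(level _ _ _ _ _) _ _ _ _ eu _ = case upper≡⇒dots≡ c l l′ eu of λ ()
word-injective c l@(up _ _)          l′@(down _ _)        _ _ _ _ eu _ = case upper≡⇒dots≡ c l l′ eu of λ ()
word-injective c l@(level _ _ _ _ _) l′@(up _ _)          _ _ _ _ eu _ = case upper≡⇒dots≡ c l l′ eu of λ ()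
word-injective c l@(level _ _ _ _ _) l′@(down _ _)        _ _ _ _ eu _ = case upper≡⇒dots≡ c l l′ eu of λ ()
word-injective c l@(down _ _)        l′@(up _ _)          _ _ _ _ eu _ = case upper≡⇒dots≡ c l l′ eu of λ ()
word-injective c l@(down _ _)        l′@(level _ _ _ _ _) _ _ _ _ eu _ = case upper≡⇒dots≡ c l l′ eu of λ ()

-- Every admissible pair of words comes from a path

¬Above : ∀ c i → ¬ Above c (suc i) c
¬Above c i = <⇒≱ (m<m+n c z<s)

¬Below : ∀ c i → ¬ Below (suc c) (suc i) c
¬Below c i lt = <⇒≱ (s≤s⁻¹ lt) (m≤n+m c i)

-- Same order as in `word-injective`: `c` is extracted from `hi` before the recursive call, and from
-- the subword `w` of `lo` after it.
word-complete : ∀ m {n c k hi lo} → n ≡ c + m →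
  Stair (Above c) (suc k) hi → length hi ≡ k + m → All (_< n) hi → Stair (Below n) 1 lo →
  (∀ {d} → c ≤ d → d < n → count d hi + count d lo ≡ 2) →
  Σ (Path k m) λ l → ∃ λ w → upper c l ≡ hi × lower c l w ≡ lo × Stair (Below c) (suc k) w
word-complete zero {c = c} {k} {[]} {lo} n≡ _ len _ t _ with refl ← trans len (+-identityʳ k) =
  done , lo , refl , refl , subst (λ n → Stair (Below n) 1 lo) (trans n≡ (+-identityʳ c)) t
-- With no column left, a letter would have to be at least `c` and less than `c + 0`.
word-complete zero {c = c} {hi = _ ∷ _} refl (p , _) len (q ∷ _) t _ = contradiction p (<⇒≱ q)
word-complete (suc m) {n} {c} {k} {hi} {lo} n≡ s len b t two
  -- The number of letters `c` in `hi` fixes the kind of step, and `two` gives the complementary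
  -- number in `lo`.
  with count c hi in e | two ≤-refl (subst (c <_) (sym n≡) (m<m+n c z<s))
... | 0 | e₂
  with l , w , refl , refl , t′ ← word-complete m {k = suc k} (trans n≡ (+-suc c m))
         (above-strict e s) (trans len (+-suc k m)) b t (two ∘ <⇒≤)
  with _ , x , y , w′ , refl , x≤y , y≤ , t″ , e₃ , refl ←
    stair-extract₂ (¬Below c) _ w t′ (trans (sym (count-lower (suc c) l w ≤-refl)) e₂)
  = up (choice x y x≤y y≤) l , w′ , refl , refl , below-strict e₃ t″
... | 1 | e₂
  with _ , a , hi′ , refl , a≤ , s′ , e₀ , refl ← stair-extract (¬Above c) _ hi s e
  with l , w , refl , refl , t′ ← word-complete m (trans n≡ (+-suc c m)) (above-strict e₀ s′)
    (suc-injective (trans (sym (length-insert a c hi′)) (trans len (+-suc k m)))) (All-insert⁻ a hi′ b) t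
    (λ c<d d<n → trans (cong (_+ _) (sym (count-insert-other a hi′ (<⇒≢ c<d)))) (two (<⇒≤ c<d) d<n))
  with _ , x , w′ , refl , x≤ , t″ , e₃ , refl ←
    stair-extract (¬Below c) _ w t′ (trans (sym (count-lower (suc c) l w ≤-refl)) (suc-injective e₂))
  = level a x a≤ x≤ l , w′ , refl , refl , below-strict e₃ t″
... | 2 | e₂
  with k′ , a , b′ , hi′ , refl , a≤b , b≤ , s′ , e₀ , refl ← stair-extract₂ (¬Above c) _ hi s e
  with l , w , refl , refl , t′ ← word-complete m (trans n≡ (+-suc c m)) (above-strict e₀ s′)
    (suc-injective (suc-injective (trans (sym (length-insert₂ a b′ c hi′)) (trans len (cong suc (+-suc k′ m))))))
    (All-insert⁻ b′ hi′ (All-insert⁻ a _ b)) t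
    (λ c<d d<n → trans (cong (_+ _) (sym (count-insert₂-other a b′ hi′ (<⇒≢ c<d)))) (two (<⇒≤ c<d) d<n))
  = down (choice a b′ a≤b b≤) l , w , refl , refl ,
    below-strict (trans (sym (count-lower (suc c) l w ≤-refl)) (suc-injective (suc-injective e₂))) t′

-- Histories

-- The choices of the up steps that are not yet matched.
data Stack : ℕ → Set where
  []  : Stack 0
  _∷_ : ∀ {k} → Choice k → Stack k → Stack (suc k)

-- A relation, so that it can be read in both directions, as encoding and as decoding. At two down
-- steps the first label lists its larger entry first and the second label its smaller one, as the
-- block conditions demand.
data Hist : ∀ {k m N M} → Path k m → Stack k → Vec Bool N → Vec (ℕ × ℕ) M → Set where
  done : Hist done [] [] []
  up : ∀ {k m N M p} {l : Path (suc k) m} {st} {s : Vec Bool N} {ξ : Vec _ M} →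
          Hist l (p ∷ st) s ξ → Hist (up p l) st (true ∷ true ∷ s) ξ
  peak : ∀ {k m N M a b a≤k b≤k} {l : Path k m} {st} {s : Vec Bool N} {ξ : Vec _ M} →
          a ≤ b → Hist l st s ξ → Hist (level a b a≤k b≤k l) st (true ∷ false ∷ s) ((a , b) ∷ ξ)
  valley : ∀ {k m N M a b a≤k b≤k} {l : Path k m} {st} {s : Vec Bool N} {ξ : Vec _ M} →
          b < a → Hist l st s ξ → Hist (level a b a≤k b≤k l) st (false ∷ true ∷ s) ((a , b) ∷ ξ)
  down  : ∀ {k m N M p p′} {l : Path k m} {st} {s : Vec Bool N} {ξ : Vec _ M} →
          Hist l st s ξ → Hist (down p l) (p′ ∷ st) (false ∷ false ∷ s) ((large p , small p) ∷ (small p′ , large p′) ∷ ξ)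

-- Only `peak` and `valley` apply to the same path, and they ask for opposite orders of `a` and `b`.
hist-functional : ∀ {k m N M} {l : Path k m} {st s s′ ξ ξ′} →
                  Hist {N = N} {M} l st s ξ → Hist l st s′ ξ′ → s ≡ s′ × ξ ≡ ξ′
hist-functional done done = refl , refl
hist-functional (up h) (up h′) with refl , refl ← hist-functional h h′ = refl , refl
hist-functional (peak _ h) (peak _ h′) with refl , refl ← hist-functional h h′ = refl , refl
hist-functional (peak a≤b _) (valley b<a _) = contradiction a≤b (<⇒≱ b<a)
hist-functional (valley b<a _) (peak a≤b _) = contradiction a≤b (<⇒≱ b<a)
hist-functional (valley _ h) (valley _ h′) with refl , refl ← hist-functional h h′ = refl , refl
hist-functional (down h) (down h′) with refl , refl ← hist-functional h h′ = refl , refl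

push-injective : ∀ {k p p′} {st st′ : Stack k} → p ∷ st ≡ p′ ∷ st′ → p ≡ p′ × st ≡ st′
push-injective refl = refl , refl

hist-injective : ∀ {k m N M} {l l′ : Path k m} {st st′ s ξ} →
                 Hist {N = N} {M} l st s ξ → Hist l′ st′ s ξ → l ≡ l′ × st ≡ st′
hist-injective done done = refl , refl
hist-injective (up h) (up h′) with refl , e ← hist-injective h h′ with refl , refl ← push-injective e = refl , refl
hist-injective (peak _ h) (peak _ h′) with refl , refl ← hist-injective h h′ = level-≡ refl refl refl , refl
hist-injective (valley _ h) (valley _ h′) with refl , refl ← hist-injective h h′ = level-≡ refl refl refl , refl
hist-injective (down {p = choice _ _ _ _} {choice _ _ _ _} h) (down {p = choice _ _ _ _} {choice _ _ _ _} h′)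
  with refl , refl ← hist-injective h h′ = cong (λ p → down p _) (choice-≡ refl refl) , cong (_∷ _) (choice-≡ refl refl)

-- Of the `2 * m` steps from height `2 * k` to 0 exactly `k + m` go down, hence the length of `ξ`.
encode : ∀ {k m N M} (l : Path k m) st → 2 * m ≡ N → k + m ≡ M → ∃₂ λ (s : Vec Bool N) (ξ : Vec _ M) → Hist l st s ξ
encode done [] refl refl = [] , [] , done
encode (up {k} {m} p l) st eN eM with refl ← trans (sym (*-suc 2 m)) eN =
  let s , ξ , h = encode l (p ∷ st) refl (trans (sym (+-suc k m)) eM) in true ∷ true ∷ s , ξ , up h
encode (level {k} {m} a b _ _ l) st eN eM
  with refl ← trans (sym (*-suc 2 m)) eN | refl ← trans (sym (+-suc k m)) eM
  with s , ξ , h ← encode l st refl refl | a ≤? b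
... | yes a≤b = true ∷ false ∷ s , (a , b) ∷ ξ , peak a≤b h
... | no a≰b  = false ∷ true ∷ s , (a , b) ∷ ξ , valley (≰⇒> a≰b) h
encode (down {k} {m} p l) (p′ ∷ st) eN eM
  with refl ← trans (sym (*-suc 2 m)) eN | refl ← trans (cong suc (sym (+-suc k m))) eM =
  let s , ξ , h = encode l st refl refl in false ∷ false ∷ s , _ , down h

-- Block conditions of a history

half-double : ∀ k → ⌊ 2 * k + 0 /2⌋ ≡ k
half-double k =
  trans (cong ⌊_/2⌋ (trans (+-identityʳ (2 * k)) (cong (k +_) (+-identityʳ k)))) (sym (n≡⌊n+n/2⌋ k))

double-shift : ∀ k u → 2 * suc k + u ≡ 2 * k + suc (suc u)
double-shift = solve-∀

double-suc : ∀ k u → 2 * suc k + u ≡ 2 + (2 * k + u)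
double-suc = solve-∀

-- The data of block j of a path that starts at height 2 k instead of 0.
block : ∀ {ℓ} {A : Set ℓ} → (Bool → Bool → ℕ → ℕ × ℕ → ℕ × ℕ → A) →
        ℕ → ∀ {N M} → Vec Bool N → Vec (ℕ × ℕ) M → ℕ → A
block f k s ξ j = f (at s (2 * j) true) (at s (suc (2 * j)) true) ⌊ 2 * k + upsBefore s (2 * j) ∸ downsBefore s (2 * j) /2⌋
                    (at ξ (downsBefore s (2 * j)) (0 , 0)) (at ξ (suc (downsBefore s (2 * j))) (0 , 0))

-- `cond` and `expo` take the looked-up data of `BlockCond` and `blockExp` as arguments, so that the
-- same shift lemmas for `block` serve both.
cond : Bool → Bool → ℕ → ℕ × ℕ → ℕ × ℕ → Set
cond true  true  k _       _       = ⊤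
cond true  false k (a , b) _       = a ≤ b × b ≤ k
cond false true  k (a , b) _       = a ≤ k × b < a
cond false false k (a , b) (c , d) = (a < k × b ≤ a) × (c ≤ d × d < k)

expo : Bool → Bool → ℕ → ℕ × ℕ → ℕ × ℕ → ℕ
expo true  true  k _       _       = 0
expo true  false k (a , b) _       = 2 * k ∸ a ∸ b
expo false true  k (a , b) _       = 2 * k ∸ a ∸ b
expo false false k (a , b) (c , d) = (2 * k ∸ 1 ∸ a ∸ b) + (2 * k ∸ 2 ∸ c ∸ d)

-- For a peak the label index is taken at position `2 * j + 1`, whereas `block` takes it at `2 * j`;
-- an up step in between does not change it.
at-up⇒downsBefore : ∀ {N} (s : Vec Bool N) t → at s t true ≡ true → downsBefore s (suc t) ≡ downsBefore s t
at-up⇒downsBefore []          t       _  = refl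
at-up⇒downsBefore (true ∷ []) zero    _  = refl
at-up⇒downsBefore (true ∷ _ ∷ _) zero _  = refl
at-up⇒downsBefore (true ∷ s)  (suc t) e  = at-up⇒downsBefore s t e
at-up⇒downsBefore (false ∷ s) (suc t) e  = cong suc (at-up⇒downsBefore s t e)

blockCond≡ : ∀ {n} (s : Steps n) (ξ : Xi n) j → BlockCond s ξ j ≡ block cond 0 s ξ j
blockCond≡ s ξ j with at s (2 * j) true in e | at s (suc (2 * j)) true
... | false | true  = refl
... | true  | false rewrite at-up⇒downsBefore s (2 * j) e = refl
... | false | false = refl
... | true  | true  = refl

blockExp≡ : ∀ {n} (s : Steps n) (ξ : Xi n) j → blockExp s ξ j ≡ block expo 0 s ξ j
blockExp≡ s ξ j with at s (2 * j) true in e | at s (suc (2 * j)) true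
... | false | true  = refl
... | true  | false rewrite at-up⇒downsBefore s (2 * j) e = refl
... | false | false = refl
... | true  | true  = refl

module _ {ℓ} {A : Set ℓ} (f : Bool → Bool → ℕ → ℕ × ℕ → ℕ × ℕ → A) where

  block-zero : ∀ k {N M} b₁ b₂ (s : Vec Bool N) (ξ : Vec _ M) →
               block f k (b₁ ∷ b₂ ∷ s) ξ 0 ≡ f b₁ b₂ k (at ξ 0 (0 , 0)) (at ξ 1 (0 , 0))
  block-zero k true  b₂ s ξ = cong (λ h → f true b₂ h _ _) (half-double k)
  block-zero k false b₂ s ξ = cong (λ h → f false b₂ h _ _) (half-double k)

  module _ (k : ℕ) {N M : ℕ} (s : Vec Bool N) (ξ : Vec (ℕ × ℕ) M) (j : ℕ) where

    private
      u = upsBefore s (2 * j)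
      d = downsBefore s (2 * j)

    -- Here and in the next three lemmas the first two steps are dropped with their labels, and
    -- their effect on the height moves into the starting height.
    block-up : block f k (true ∷ true ∷ s) ξ (suc j) ≡ block f (suc k) s ξ j
    block-up rewrite +-suc j (j + 0) =
      cong (λ h → f (at s (2 * j) true) (at s (suc (2 * j)) true) ⌊ h ∸ d /2⌋ (at ξ d (0 , 0)) (at ξ (suc d) (0 , 0)))
        (sym (double-shift k u))

    block-peak : ∀ x → block f k (true ∷ false ∷ s) (x ∷ ξ) (suc j) ≡ block f k s ξ j
    block-peak x rewrite +-suc j (j + 0) =
      cong (λ h → f (at s (2 * j) true) (at s (suc (2 * j)) true) ⌊ h ∸ suc d /2⌋ (at ξ d (0 , 0)) (at ξ (suc d) (0 , 0)))
        (+-suc (2 * k) u)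

    block-valley : ∀ x → block f k (false ∷ true ∷ s) (x ∷ ξ) (suc j) ≡ block f k s ξ j
    block-valley x rewrite +-suc j (j + 0) =
      cong (λ h → f (at s (2 * j) true) (at s (suc (2 * j)) true) ⌊ h ∸ suc d /2⌋ (at ξ d (0 , 0)) (at ξ (suc d) (0 , 0)))
        (+-suc (2 * k) u)

    block-down : ∀ x y → block f (suc k) (false ∷ false ∷ s) (x ∷ y ∷ ξ) (suc j) ≡ block f k s ξ j
    block-down x y rewrite +-suc j (j + 0) | +-suc k (k + 0) = refl

hist-cond : ∀ {k m N M} {l : Path k m} {st s ξ} → Hist {N = N} {M} l st s ξ → ∀ j → j < m → block cond k s ξ j
hist-cond {k} (up {s = s} {ξ} h) zero _ = subst id (sym (block-zero cond k true true s ξ)) tt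
hist-cond {k} (up {s = s} {ξ} h) (suc j) (s≤s lt) =
  subst id (sym (block-up cond k s ξ j)) (hist-cond h j lt)
hist-cond {k} (peak {b≤k = b≤k} {s = s} {ξ} a≤b h) zero _ =
  subst id (sym (block-zero cond k true false s (_ ∷ ξ))) (a≤b , b≤k)
hist-cond {k} (peak {a = a} {b} {s = s} {ξ} _ h) (suc j) (s≤s lt) =
  subst id (sym (block-peak cond k s ξ j (a , b))) (hist-cond h j lt)
hist-cond {k} (valley {a≤k = a≤k} {s = s} {ξ} b<a h) zero _ =
  subst id (sym (block-zero cond k false true s (_ ∷ ξ))) (a≤k , b<a)
hist-cond {k} (valley {a = a} {b} {s = s} {ξ} _ h) (suc j) (s≤s lt) =
  subst id (sym (block-valley cond k s ξ j (a , b))) (hist-cond h j lt)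
hist-cond {suc k} (down {p = p} {p′} {s = s} {ξ} h) zero _ =
  subst id (sym (block-zero cond (suc k) false false s (_ ∷ _ ∷ ξ))) ((s≤s (bounded p) , ordered p) , ordered p′ , s≤s (bounded p′))
hist-cond {suc k} (down {p = p} {p′} {s = s} {ξ} h) (suc j) (s≤s lt) =
  subst id (sym (block-down cond k s ξ j (large p , small p) (small p′ , large p′))) (hist-cond h j lt)

hist-nonneg : ∀ {k m N M} {l : Path k m} {st s ξ} → Hist {N = N} {M} l st s ξ → ∀ t → downsBefore s t ≤ 2 * k + upsBefore s t
hist-nonneg done t = z≤n
hist-nonneg (up h) 0 = z≤n
hist-nonneg (up h) 1 = z≤n
hist-nonneg {k} (up {s = s} h) (suc (suc t)) = subst (downsBefore s t ≤_) (double-shift k (upsBefore s t)) (hist-nonneg h t)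
hist-nonneg (peak _ h) 0 = z≤n
hist-nonneg (peak _ h) 1 = z≤n
hist-nonneg {k} (peak {s = s} _ h) (suc (suc t)) =
  ≤-trans (s≤s (hist-nonneg h t)) (≤-reflexive (sym (+-suc (2 * k) (upsBefore s t))))
hist-nonneg (valley _ h) 0 = z≤n
-- A valley begins with a down step; `b < a ≤ k` shows that the height is positive there.
hist-nonneg (valley {a≤k = a≤k} b<a h) 1 with s≤s _ ← ≤-trans b<a a≤k = s≤s z≤n
hist-nonneg {k} (valley {s = s} _ h) (suc (suc t)) =
  ≤-trans (s≤s (hist-nonneg h t)) (≤-reflexive (sym (+-suc (2 * k) (upsBefore s t))))
hist-nonneg (down h) 0 = z≤n
hist-nonneg (down h) 1 = s≤s z≤n
hist-nonneg {suc k} (down {s = s} h) (suc (suc t)) =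
  subst (2 + downsBefore s t ≤_) (sym (double-suc k (upsBefore s t))) (s≤s (s≤s (hist-nonneg h t)))

hist-ends : ∀ {k m N M} {l : Path k m} {st s ξ} → Hist {N = N} {M} l st s ξ → 2 * k + upsBefore s N ≡ downsBefore s N
hist-ends done = refl
hist-ends {k} (up {N = N} {s = s} h) = trans (sym (double-shift k (upsBefore s N))) (hist-ends h)
hist-ends {k} (peak _ h) = trans (+-suc (2 * k) _) (cong suc (hist-ends h))
hist-ends {k} (valley _ h) = trans (+-suc (2 * k) _) (cong suc (hist-ends h))
hist-ends {suc k} (down {N = N} {s = s} h) = trans (double-suc k (upsBefore s N)) (cong (2 +_) (hist-ends h))

-- The stack is an output: double descents push onto it and double ascents pop it, as the recursion
-- returns from the end of the path.
hist-complete : ∀ m {k N M} (s : Vec Bool N) (ξ : Vec _ M) → N ≡ 2 * m → M ≡ k + m →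
                2 * k + upsBefore s N ≡ downsBefore s N → (∀ j → j < m → block cond k s ξ j) →
                Σ (Path k m) λ l → ∃ λ st → Hist l st s ξ
hist-complete zero {zero} [] [] _ _ _ _ = done , [] , done
hist-complete zero {suc _} [] _ _ _ () _
hist-complete (suc m) [] ξ () _ _ _
hist-complete (suc m) (_ ∷ []) ξ eN _ _ _ = contradiction (trans eN (*-suc 2 m)) λ ()
hist-complete (suc m) {k} (true ∷ true ∷ s) ξ eN eM e c
  with hist-complete m {suc k} s ξ (suc-injective (suc-injective (trans eN (*-suc 2 m)))) (trans eM (+-suc k m))
         (trans (double-shift k _) e) (λ j lt → subst id (block-up cond k s ξ j) (c (suc j) (s≤s lt)))
-- The top `p` is the second label of the matching double descent.
... | l , p ∷ st , h = up p l , st , up h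
hist-complete (suc m) {k} (true ∷ false ∷ s) [] eN eM e c = contradiction (trans eM (+-suc k m)) λ ()
hist-complete (suc m) {k} (true ∷ false ∷ s) ((a , b) ∷ ξ) eN eM e c
  with a≤b , b≤k ← subst id (block-zero cond k true false s ((a , b) ∷ ξ)) (c 0 (s≤s z≤n))
  with l , st , h ← hist-complete m {k} s ξ
         (suc-injective (suc-injective (trans eN (*-suc 2 m)))) (suc-injective (trans eM (+-suc k m)))
         (suc-injective (trans (sym (+-suc (2 * k) _)) e)) (λ j lt → subst id (block-peak cond k s ξ j (a , b)) (c (suc j) (s≤s lt)))
  = level a b (≤-trans a≤b b≤k) b≤k l , st , peak a≤b h
hist-complete (suc m) {k} (false ∷ true ∷ s) [] eN eM e c = contradiction (trans eM (+-suc k m)) λ ()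
hist-complete (suc m) {k} (false ∷ true ∷ s) ((a , b) ∷ ξ) eN eM e c
  with a≤k , b<a ← subst id (block-zero cond k false true s ((a , b) ∷ ξ)) (c 0 (s≤s z≤n))
  with l , st , h ← hist-complete m {k} s ξ
         (suc-injective (suc-injective (trans eN (*-suc 2 m)))) (suc-injective (trans eM (+-suc k m)))
         (suc-injective (trans (sym (+-suc (2 * k) _)) e)) (λ j lt → subst id (block-valley cond k s ξ j (a , b)) (c (suc j) (s≤s lt)))
  = level a b a≤k (≤-trans (<⇒≤ b<a) a≤k) l , st , valley b<a h
hist-complete (suc m) {zero} (false ∷ false ∷ s) ξ eN eM e c
  -- Two down steps from height 0 would need a first label entry less than 0.
  with () , _ ← proj₁ (subst id (block-zero cond 0 false false s ξ) (c 0 (s≤s z≤n)))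
hist-complete (suc m) {suc k} (false ∷ false ∷ s) [] eN () e c
hist-complete (suc m) {suc k} (false ∷ false ∷ s) (_ ∷ []) eN eM e c = contradiction (trans (suc-injective eM) (+-suc k m)) λ ()
hist-complete (suc m) {suc k} (false ∷ false ∷ s) ((a , b) ∷ (a′ , b′) ∷ ξ) eN eM e c
  with (s≤s a≤k , b≤a) , (a′≤b′ , s≤s b′≤k)
    ← subst id (block-zero cond (suc k) false false s ((a , b) ∷ (a′ , b′) ∷ ξ)) (c 0 (s≤s z≤n))
  with l , st , h ← hist-complete m {k} s ξ
         (suc-injective (suc-injective (trans eN (*-suc 2 m)))) (suc-injective (trans (suc-injective eM) (+-suc k m)))
         (suc-injective (suc-injective (trans (sym (double-suc k _)) e)))
         (λ j lt → subst id (block-down cond k s ξ j (a , b) (a′ , b′)) (c (suc j) (s≤s lt)))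
  -- The first label, with its entries swapped, is the choice of this step; the second one waits for
  -- the matching up step.
  = down (choice b a b≤a a≤k) l , choice a′ b′ a′≤b′ b′≤k ∷ st , down h

-- Weight against inversions

weight : ∀ {k m} → Path k m → Stack k → ℕ
weight done                []       = 0
weight (up p l)            st       = weight l (p ∷ st)
weight {k} (level a b _ _ l) st     = 2 * k ∸ a ∸ b + weight l st
weight {k} (down p l)      (q ∷ st) =
  (2 * k ∸ 1 ∸ large p ∸ small p) + (2 * k ∸ 2 ∸ small q ∸ large q) + weight l st

applyUpTo-cong : ∀ {f g : ℕ → ℕ} → (∀ j → f j ≡ g j) → ∀ m → applyUpTo f m ≡ applyUpTo g m
applyUpTo-cong e zero    = refl
applyUpTo-cong e (suc m) = cong₂ _∷_ (e 0) (applyUpTo-cong (e ∘ suc) m)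

hist-weight : ∀ {k m N M} {l : Path k m} {st s ξ} → Hist {N = N} {M} l st s ξ →
              sum (applyUpTo (block expo k s ξ) m) ≡ weight l st
hist-weight done = refl
hist-weight {k} (up {m = m} {s = s} {ξ} h) = cong₂ _+_ (block-zero expo k true true s ξ)
  (trans (cong sum (applyUpTo-cong (block-up expo k s ξ) m)) (hist-weight h))
hist-weight {k} (peak {m = m} {a = a} {b} {s = s} {ξ} _ h) = cong₂ _+_ (block-zero expo k true false s ((a , b) ∷ ξ))
  (trans (cong sum (applyUpTo-cong (λ j → block-peak expo k s ξ j (a , b)) m)) (hist-weight h))
hist-weight {k} (valley {m = m} {a = a} {b} {s = s} {ξ} _ h) = cong₂ _+_ (block-zero expo k false true s ((a , b) ∷ ξ))
  (trans (cong sum (applyUpTo-cong (λ j → block-valley expo k s ξ j (a , b)) m)) (hist-weight h))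
hist-weight {suc k} (down {m = m} {p = p} {q} {s = s} {ξ} h) = cong₂ _+_
  (block-zero expo (suc k) false false s ((large p , small p) ∷ (small q , large q) ∷ ξ))
  (trans (cong sum (applyUpTo-cong (λ j → block-down expo k s ξ j (large p , small p) (small q , large q)) m)) (hist-weight h))

triangle : ℕ → ℕ
triangle zero    = 0
triangle (suc n) = n + triangle n

triangle≡C : ∀ n → triangle n ≡ n C 2
triangle≡C zero    = refl
triangle≡C (suc n) = trans (cong₂ _+_ (sym (nC1≡n n)) (triangle≡C n)) (nCk+nC[k+1]≡[n+1]C[k+1] n 1)

load : ∀ {k} → Stack k → ℕ
load []       = 0
load (p ∷ st) = small p + large p + load st

above-Before : ∀ {k m} c (l : Path k m) → All (Before (λ x y → y <ᵇ x) c) (upper (suc c) l)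
above-Before c l = All.map (λ c<x → <ᵇ-true c<x , <ᵇ-false (<⇒≤ c<x)) (upper-≥ (suc c) l)

below-Before : ∀ {c w} → All (_< c) w → All (Before _<ᵇ_ c) w
below-Before = All.map (λ x<c → <ᵇ-true x<c , <ᵇ-false (<⇒≤ x<c))

larger-absent : ∀ {c w} → All (_< suc c) w → larger c w ≡ 0
larger-absent = tally-zero ∘ All.map (cong χ ∘ <ᵇ-false ∘ s≤s⁻¹)

∸∸-+ : ∀ {n} a b → a + b ≤ n → (n ∸ a ∸ b) + (a + b) ≡ n
∸∸-+ {n} a b le = trans (cong (_+ (a + b)) (∸-+-assoc n a b)) (m∸n+n≡m le)

-- Counts the lower dots that form an inversion with an upper dot of column `c`; all of them come
-- from later columns.
larger-rest : ∀ {k m} c (l : Path k m) w → All (_< suc c) w → larger c (lower (suc c) l w) + k ≡ m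
larger-rest {k} {m} c l w ps = trans (larger-lower (suc c) l w ≤-refl) (cong (_+ m) (larger-absent ps))

-- The subtrahends of the weight are the inversions created by the insertions, except that those of an up step are
-- only accounted for at the matching down step; until then they are in load st.
energy : ∀ {k m} c (l : Path k m) st w → All (_< c) w → length w ≡ c + k →
         coinversions (lower c l w) + cross (lower c l w) (upper c l) + inversions (upper c l) + weight l st + load st
         ≡ coinversions w + triangle (k + m)
energy c done [] w _ _ = shuffle (coinversions w)
  where
  shuffle : ∀ x → x + 0 + 0 + 0 + 0 ≡ x + 0
  shuffle = solve-∀
-- Pushing `p` raises the load by the same amount as inserting the pair raises `coinversions w`, so
-- this amount cancels.
energy c (up {k} {m} p l) st w ps n = +-cancelˡ-≡ (small p + large p) _ _ (begin
  s + (X + Y + Z + W + load st)                        ≡⟨ shuffle s X Y Z W (load st) ⟩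
  X + Y + Z + W + (s + load st)                        ≡⟨ energy (suc c) l (p ∷ st) w′ (insertPair-< p ps) (length-insertPair p w n) ⟩
  coinversions w′ + triangle (suc k + m)               ≡⟨ cong₂ _+_ (pairs-insert₂ _<ᵇ_ (small p) (large p) (<ᵇ-false (≤-refl {c})) (below-Before ps)
                                                             (ordered p) (≤-trans (bounded p) (room c n)))
                                                             (cong triangle (sym (+-suc k m))) ⟩
  s + coinversions w + triangle (k + suc m)            ≡⟨ +-assoc s _ _ ⟩
  s + (coinversions w + triangle (k + suc m))          ∎)
  where
  open ≡-Reasoning
  s  = small p + large p
  w′ = insertPair p c w
  X  = coinversions (lower (suc c) l w′)
  Y  = cross (lower (suc c) l w′) (upper (suc c) l)
  Z  = inversions (upper (suc c) l)
  W  = weight l (p ∷ st)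
  shuffle : ∀ s x y z w t → s + (x + y + z + w + t) ≡ x + y + z + w + (s + t)
  shuffle = solve-∀
energy c (level {k} {m} a b a≤k b≤k l) st w ps n = begin
  X + cross L (insert a c H) + inversions (insert a c H) + (ω + W) + load st
    -- The upper dot of column `c` has inversions with `g` lower dots and with the `a` upper dots in
    -- the rows below it.
    ≡⟨ cong₂ (λ y z → X + y + z + (ω + W) + load st) (tally-insert (λ y → larger y L) a c H)
         (pairs-insert (λ x y → y <ᵇ x) a (above-Before c l) (≤-trans a≤k (upper-room (suc c) l))) ⟩
  X + (g + Y) + (a + Z) + (ω + W) + load st            ≡⟨ shuffle X Y Z W (load st) g a ω ⟩
  X + Y + Z + W + load st + (g + a + ω)
    ≡⟨ cong (_+ (g + a + ω)) (energy (suc c) l st w′ w′< (trans (length-insert b c w) (cong suc n))) ⟩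
  coinversions w′ + triangle (k + m) + (g + a + ω)
    ≡⟨ cong (λ x → x + triangle (k + m) + (g + a + ω)) (pairs-insert _<ᵇ_ b (below-Before ps) (≤-trans b≤k (room c n))) ⟩
  b + coinversions w + triangle (k + m) + (g + a + ω)  ≡⟨ shuffle₂ b (coinversions w) (triangle (k + m)) g a ω ⟩
  coinversions w + triangle (k + m) + (g + (ω + (a + b)))
    ≡⟨ cong (λ x → coinversions w + triangle (k + m) + (g + x))
         (∸∸-+ a b (+-mono-≤ a≤k (≤-trans b≤k (m≤m+n k 0)))) ⟩
  coinversions w + triangle (k + m) + (g + 2 * k)      ≡⟨ shuffle₃ (coinversions w) (triangle (k + m)) g k ⟩
  coinversions w + (k + (g + k) + triangle (k + m))
    -- As `g + k ≡ m`, the column contributes `k + m`, the next summand of the triangle number.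
    ≡⟨ cong (λ x → coinversions w + (k + x + triangle (k + m))) (larger-rest c l w′ w′<) ⟩
  coinversions w + triangle (suc (k + m))              ≡⟨ cong (λ x → coinversions w + triangle x) (sym (+-suc k m)) ⟩
  coinversions w + triangle (k + suc m)                ∎
  where
  open ≡-Reasoning
  w′ = insert b c w
  w′< = All-insert b (≤-refl {suc c}) (All.map m≤n⇒m≤1+n ps)
  L  = lower (suc c) l w′
  H  = upper (suc c) l
  X  = coinversions L
  Y  = cross L H
  Z  = inversions H
  W  = weight l st
  g  = larger c L
  ω  = 2 * k ∸ a ∸ b
  shuffle : ∀ x y z w s g a ω → x + (g + y) + (a + z) + (ω + w) + s ≡ x + y + z + w + s + (g + a + ω)
  shuffle = solve-∀
  shuffle₂ : ∀ b x t g a ω → b + x + t + (g + a + ω) ≡ x + t + (g + (ω + (a + b)))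
  shuffle₂ = solve-∀
  shuffle₃ : ∀ x t g k → x + t + (g + 2 * k) ≡ x + (k + (g + k) + t)
  shuffle₃ = solve-∀
energy c (down {k} {m} p l) (q ∷ st) w ps n = begin
  X + cross L (insertPair p c H) + inversions (insertPair p c H) + (ω₁ + ω₂ + W) + (small q + large q + load st)
    ≡⟨ cong₂ (λ y z → X + y + z + (ω₁ + ω₂ + W) + (small q + large q + load st))
         (tally-insert₂ (λ y → larger y L) (small p) (large p) c H)
         (pairs-insert₂ (λ x y → y <ᵇ x) (small p) (large p) (<ᵇ-false (≤-refl {c})) (above-Before c l) (ordered p)
           (≤-trans (bounded p) (upper-room (suc c) l))) ⟩
  X + (g + (g + Y)) + (small p + large p + Z) + (ω₁ + ω₂ + W) + (small q + large q + load st)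
    -- The popped choice `q` leaves the load and completes `ω₂`, while the inversions created by `p`
    -- complete `ω₁`.
    ≡⟨ shuffle X Y Z W (load st) g (small p) (large p) ω₁ (small q) (large q) ω₂ ⟩
  X + Y + Z + W + load st + (g + g + (ω₁ + (large p + small p)) + (ω₂ + (small q + large q)))
    ≡⟨ cong₂ (λ x y → x + (g + g + y + (ω₂ + (small q + large q))))
         (energy (suc c) l st w w< (trans n (+-suc c k)))
         (∸∸-+ (large p) (small p) (+-mono-≤ (bounded p)
           (≤-trans (≤-trans (ordered p) (bounded p)) (≤-trans (n≤1+n k) (s≤s (m≤m+n k 0)))))) ⟩
  coinversions w + triangle (k + m) + (g + g + (2 * suc k ∸ 1) + (ω₂ + (small q + large q)))
    ≡⟨ cong (λ y → coinversions w + triangle (k + m) + (g + g + (2 * suc k ∸ 1) + y))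
         (trans (∸∸-+ (small q) (large q) (subst (small q + large q ≤_) (sym (double-pred k))
            (+-mono-≤ (≤-trans (ordered q) (bounded q)) (≤-trans (bounded q) (m≤m+n k 0))))) (double-pred k)) ⟩
  coinversions w + triangle (k + m) + (g + g + (k + suc (k + 0)) + 2 * k)
    -- With `g + k ≡ m` the two dots contribute the two summands `suc (k + m)` and `k + m`.
    ≡⟨ shuffle₂ (coinversions w) (triangle (k + m)) g k ⟩
  coinversions w + (suc (k + (g + k)) + (k + (g + k) + triangle (k + m)))
    ≡⟨ cong (λ x → coinversions w + (suc (k + x) + (k + x + triangle (k + m)))) (larger-rest c l w w<) ⟩
  coinversions w + triangle (suc (suc (k + m)))
    ≡⟨ cong (λ x → coinversions w + triangle (suc x)) (sym (+-suc k m)) ⟩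
  coinversions w + triangle (suc k + suc m)            ∎
  where
  open ≡-Reasoning
  w< : All (_< suc c) w
  w< = All.map m≤n⇒m≤1+n ps
  L  = lower (suc c) l w
  H  = upper (suc c) l
  X  = coinversions L
  Y  = cross L H
  Z  = inversions H
  W  = weight l st
  g  = larger c L
  ω₁ = 2 * suc k ∸ 1 ∸ large p ∸ small p
  ω₂ = 2 * suc k ∸ 2 ∸ small q ∸ large q
  double-pred : ∀ k → 2 * suc k ∸ 2 ≡ 2 * k
  double-pred k = cong (_∸ 2) (*-suc 2 k)
  shuffle : ∀ x y z w s g a b ω a′ b′ ω′ →
            x + (g + (g + y)) + (a + b + z) + (ω + ω′ + w) + (a′ + b′ + s)
            ≡ x + y + z + w + s + (g + g + (ω + (b + a)) + (ω′ + (a′ + b′)))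
  shuffle = solve-∀
  shuffle₂ : ∀ x t g k → x + t + (g + g + (k + suc (k + 0)) + 2 * k) ≡ x + (suc (k + (g + k)) + (k + (g + k) + t))
  shuffle₂ = solve-∀

-- Placements as words

letters : ∀ {n N} → Vec (Fin n) N → List ℕ
letters []      = []
letters (x ∷ v) = toℕ x ∷ letters v

letters-injective : ∀ {n N} (v v′ : Vec (Fin n) N) → letters v ≡ letters v′ → v ≡ v′
letters-injective []      []        _ = refl
letters-injective (x ∷ v) (x′ ∷ v′) e =
  cong₂ _∷_ (toℕ-injective (∷-injectiveˡ e)) (letters-injective v v′ (∷-injectiveʳ e))

length-letters : ∀ {n N} (v : Vec (Fin n) N) → length (letters v) ≡ N
length-letters []      = refl
length-letters (x ∷ v) = cong suc (length-letters v)

letters-< : ∀ {n N} (v : Vec (Fin n) N) → All (_< n) (letters v)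
letters-< []      = []
letters-< (x ∷ v) = toℕ<n x ∷ letters-< v

fromLetters : ∀ {n N} w → All (_< n) w → length w ≡ N → ∃ λ (v : Vec (Fin n) N) → letters v ≡ w
fromLetters []      _        refl = [] , refl
fromLetters (x ∷ w) (p ∷ ps) refl =
  let v , e = fromLetters w ps refl in fromℕ< p ∷ v , cong₂ _∷_ (toℕ-fromℕ< p) e

≟-does : ∀ {n} (x c : Fin n) → does (x F.≟ c) ≡ (toℕ x ≡ᵇ toℕ c)
≟-does F.zero    F.zero    = refl
≟-does F.zero    (F.suc c) = refl
≟-does (F.suc x) F.zero    = refl
≟-does (F.suc x) (F.suc c) = ≟-does x c

count-letters : ∀ {n N} (c : Fin n) (v : Vec (Fin n) N) → V.count (F._≟ c) v ≡ count (toℕ c) (letters v)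
count-letters c []      = refl
count-letters c (x ∷ v) rewrite ≟-does x c with toℕ x ≡ᵇ toℕ c
... | true  = cong suc (count-letters c v)
... | false = count-letters c v

tally-letters : ∀ f {n N} (v : Vec (Fin n) N) → sum (tabulate (λ r → f (toℕ (lookup v r)))) ≡ tally f (letters v)
tally-letters f []      = refl
tally-letters f (x ∷ v) = cong (f (toℕ x) +_) (tally-letters f v)

-- The sum of `invP` for any number of rows, which permits induction on the vector.
invV : ∀ {n N} → Vec (Fin n) N → ℕ
invV v = sum (tabulate (λ r → sum (tabulate (λ r′ →
           if toℕ r <ᵇ toℕ r′ then χ (toℕ (lookup v r′) <ᵇ toℕ (lookup v r)) else 0))))

invV-letters : ∀ {n N} (v : Vec (Fin n) N) → invV v ≡ inversions (letters v)
invV-letters []      = refl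
invV-letters (x ∷ v) = cong₂ _+_ (tally-letters (λ y → χ (y <ᵇ toℕ x)) v) (invV-letters v)

invP-letters : ∀ {n} (v : Placement n) → invP v ≡ inversions (letters v)
invP-letters {n} v = trans (cong sum (trans (map-tabulate id _)
  (tabulate-cong λ r → cong sum (map-tabulate id λ r′ →
     if toℕ r <ᵇ toℕ r′ then χ (toℕ (lookup v r′) <ᵇ toℕ (lookup v r)) else 0)))) (invV-letters v)

-- Cutting a word in the middle

-- Moving letters onto `r` one at a time yields the lower rows already in reversed order, as `lower`
-- produces them.
split : ∀ n {m} (r w : List ℕ) → length w ≡ n + m → ∃₂ λ r′ h → r ʳ++ w ≡ r′ ʳ++ h × length r′ ≡ n + length r × length h ≡ m
split zero    r w       e = r , w , refl , refl , e
split (suc n) r (x ∷ w) e with r′ , h , e₁ , e₂ , e₃ ← split n (x ∷ r) w (suc-injective e) =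
  r′ , h , e₁ , trans e₂ (+-suc n (length r)) , e₃

ʳ++-injective : ∀ (r r′ : List ℕ) {h h′} → length r ≡ length r′ → r ʳ++ h ≡ r′ ʳ++ h′ → r ≡ r′ × h ≡ h′
ʳ++-injective []      []        _ e = refl , e
ʳ++-injective (x ∷ r) (x′ ∷ r′) n e with refl , refl ← ʳ++-injective r r′ (suc-injective n) e = refl , refl

ʳ++-All⁺ : ∀ {P : ℕ → Set} {r h} → All P r → All P h → All P (r ʳ++ h)
ʳ++-All⁺ []       qs = qs
ʳ++-All⁺ (p ∷ ps) qs = ʳ++-All⁺ ps (p ∷ qs)

ʳ++-All⁻ : ∀ {P : ℕ → Set} r {h} → All P (r ʳ++ h) → All P r × All P h
ʳ++-All⁻ []      qs = [] , qs
ʳ++-All⁻ (x ∷ r) qs with ps , p ∷ qs′ ← ʳ++-All⁻ r qs = p ∷ ps , qs′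

tally-ʳ++ : ∀ f r h → tally f (r ʳ++ h) ≡ tally f r + tally f h
tally-ʳ++ f []      h = refl
tally-ʳ++ f (x ∷ r) h = trans (tally-ʳ++ f r (x ∷ h)) (shuffle (tally f r) (f x) (tally f h))
  where
  shuffle : ∀ a b c → a + (b + c) ≡ b + a + c
  shuffle = solve-∀

cross-∷ : ∀ x r h → cross (x ∷ r) h ≡ smaller x h + cross r h
cross-∷ x r []      = refl
cross-∷ x r (y ∷ h) rewrite cross-∷ x r h = shuffle (χ (y <ᵇ x)) (larger y r) (smaller x h) (cross r h)
  where
  shuffle : ∀ a b c d → a + b + (c + d) ≡ a + c + (b + d)
  shuffle = solve-∀

cross-[] : ∀ h → cross [] h ≡ 0
cross-[] []      = refl
cross-[] (x ∷ h) = cross-[] h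

-- An inversion lies within the reversed half, between the halves, or within the second half.
inversions-ʳ++ : ∀ r h → inversions (r ʳ++ h) ≡ coinversions r + cross r h + inversions h
inversions-ʳ++ []      h rewrite cross-[] h = refl
inversions-ʳ++ (x ∷ r) h rewrite cross-∷ x r h | inversions-ʳ++ r (x ∷ h) =
  shuffle (coinversions r) (larger x r) (cross r h) (smaller x h) (inversions h)
  where
  shuffle : ∀ c l k s i → c + (l + k) + (s + i) ≡ l + c + (s + k) + i
  shuffle = solve-∀

-- In RevPos the word is reversed: its last letter has position 0.
Pos : (ℕ → ℕ → Set) → ℕ → List ℕ → Set
Pos R i []      = ⊤
Pos R i (x ∷ w) = R i x × Pos R (suc i) w

RevPos : (ℕ → ℕ → Set) → List ℕ → Set
RevPos R []      = ⊤
RevPos R (x ∷ r) = R (length r) x × RevPos R r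

pos-ʳ++⁺ : ∀ {R} r h → RevPos R r → Pos R (length r) h → Pos R 0 (r ʳ++ h)
pos-ʳ++⁺ []      h _       qs = qs
pos-ʳ++⁺ (x ∷ r) h (p , ps) qs = pos-ʳ++⁺ r (x ∷ h) ps (p , qs)

pos-ʳ++⁻ : ∀ {R} r h → Pos R 0 (r ʳ++ h) → RevPos R r × Pos R (length r) h
pos-ʳ++⁻ []      h qs = tt , qs
pos-ʳ++⁻ (x ∷ r) h qs with ps , p , qs′ ← pos-ʳ++⁻ r (x ∷ h) qs = (p , ps) , qs′

pos-letters⁺ : ∀ {R : ℕ → ℕ → Set} i {n N} (v : Vec (Fin n) N) →
               (∀ r → R (i + toℕ r) (toℕ (lookup v r))) → Pos R i (letters v)
pos-letters⁺ i []      f = tt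
pos-letters⁺ {R} i (x ∷ v) f = subst (λ j → R j _) (+-identityʳ i) (f F.zero) ,
  pos-letters⁺ (suc i) v (λ r → subst (λ j → R j (toℕ (lookup v r))) (+-suc i (toℕ r)) (f (F.suc r)))

pos-letters⁻ : ∀ {R : ℕ → ℕ → Set} i {n N} (v : Vec (Fin n) N) →
               Pos R i (letters v) → ∀ r → R (i + toℕ r) (toℕ (lookup v r))
pos-letters⁻ {R} i (x ∷ v) (p , ps) F.zero    = subst (λ j → R j _) (sym (+-identityʳ i)) p
pos-letters⁻ {R} i (x ∷ v) (p , ps) (F.suc r) = subst (λ j → R j (toℕ (lookup v r))) (sym (+-suc i (toℕ r)))
  (pos-letters⁻ (suc i) v ps r)

-- Cell bounds as staircases

Cell : ℕ → ℕ → ℕ → Set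
Cell n i x = x ≤ i × i ≤ x + n

stair-shift : ∀ {P : ℕ → ℕ → Set} w → Stair P 0 w → Stair (P ∘ suc) 1 w
stair-shift []      _ = tt
stair-shift (x ∷ w) s = s

below-unshift : ∀ {c} w → Stair (Below (suc c)) 0 w → Stair (Below c) 1 w
below-unshift w s = stair-map (λ i → s≤s⁻¹) 1 w (stair-shift w s)

above-unshift : ∀ {c} w → Stair (Above c) 0 w → Stair (Above (suc c)) 1 w
above-unshift {c} w s = stair-map (λ i → ≤-trans (≤-reflexive (sym (+-suc c i)))) 1 w (stair-shift w s)

cell⇒below : ∀ {n} r → RevPos (Cell n) r → Stair (Below (length r)) 1 r
cell⇒below []      _              = tt
cell⇒below (x ∷ r) ((x≤ , _) , ps) = s≤s x≤ , below-weaken (cell⇒below r ps)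

-- In the rows below `n` the bound `i ≤ x + n` is automatic, so the staircase has to supply only
-- `x ≤ i`.
below⇒cell : ∀ {n} r → length r ≤ n → Stair (Below (length r)) 1 r → RevPos (Cell n) r
below⇒cell []      _  _        = tt
below⇒cell (x ∷ r) le (x< , s) = (s≤s⁻¹ x< , ≤-trans (<⇒≤ le) (m≤n+m _ x)) , below⇒cell r (<⇒≤ le) (below-unshift r s)

cell⇒above : ∀ {n} c h → Pos (Cell n) (n + c) h → Stair (Above c) 1 h
cell⇒above c []      _               = tt
cell⇒above {n} c (x ∷ h) ((_ , ≤x) , ps) =
  ≤-trans (≤-reflexive (+-identityʳ c)) (+-cancelˡ-≤ n c x (≤-trans ≤x (≤-reflexive (+-comm x n)))) ,
  above-weaken (cell⇒above (suc c) h (subst (λ i → Pos (Cell n) i h) (sym (+-suc n c)) ps))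

-- From row `n` on it is `x ≤ i` that is automatic, because `x < n`.
above⇒cell : ∀ {n} c h → All (_< n) h → Stair (Above c) 1 h → Pos (Cell n) (n + c) h
above⇒cell c []      _        _        = tt
above⇒cell {n} c (x ∷ h) (x<n ∷ ps) (c≤x , s) =
  (≤-trans (<⇒≤ x<n) (m≤m+n n c) ,
   ≤-trans (+-monoʳ-≤ n (≤-trans (≤-reflexive (sym (+-identityʳ c))) c≤x)) (≤-reflexive (+-comm n x))) ,
  subst (λ i → Pos (Cell n) i h) (+-suc n c) (above⇒cell (suc c) h ps (above-unshift h s))

-- Dellac configurations and paths

word : ∀ {n} → Path 0 n → List ℕ
word l = lower 0 l [] ʳ++ upper 0 l

length-lower₀ : ∀ {n} (l : Path 0 n) → length (lower 0 l []) ≡ n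
length-lower₀ l = trans (sym (+-identityʳ _)) (length-lower 0 l [])

cells⇒path : ∀ {n} r h → length r ≡ n → length h ≡ n → All (_< n) (r ʳ++ h) → Pos (Cell n) 0 (r ʳ++ h) →
             (∀ {d} → d < n → count d (r ʳ++ h) ≡ 2) → Σ (Path 0 n) λ l → r ʳ++ h ≡ word l
cells⇒path r h refl lh b cs two
  with cr , ch ← pos-ʳ++⁻ r h cs
  with word-complete (length r) refl (cell⇒above 0 h (subst (λ i → Pos (Cell (length r)) i h) (sym (+-identityʳ _)) ch))
         lh (proj₂ (ʳ++-All⁻ r b)) (cell⇒below r cr)
         (λ {d} _ d<n → trans (+-comm (count d h) _) (trans (sym (tally-ʳ++ _ r h)) (two d<n)))
-- `Below 0` admits no letter, so the initial subword is empty.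
... | l , [] , eu , el , _ = l , sym (cong₂ _ʳ++_ el eu)

dellac⇒path : ∀ {n} (v : Placement n) → IsDellac n v → Σ (Path 0 n) λ l → letters v ≡ word l
dellac⇒path {n} v isD
  with r , h , e , lr , lh ← split n [] (letters v) (length-letters v)
  with l , e′ ← cells⇒path r h (trans lr (+-identityʳ n)) (trans lh (+-identityʳ n)) (subst (All (_< n)) e (letters-< v))
         (subst (Pos (Cell n) 0) e (pos-letters⁺ 0 v λ i → IsDellac.lowerBound isD i , IsDellac.upperBound isD i))
         (λ {d} d<n → subst (λ w → count d w ≡ 2) e (subst (λ d → count d (letters v) ≡ 2) (toℕ-fromℕ< d<n)
           (trans (sym (count-letters (fromℕ< d<n) v)) (IsDellac.twoPerColumn isD (fromℕ< d<n)))))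
  = l , trans e e′

path⇒dellac : ∀ {n} (l : Path 0 n) → Σ (DC n) λ D → letters (proj₁ D) ≡ word l
path⇒dellac {n} l = (v , record
  { twoPerColumn = λ c → trans (count-letters c v) (trans (cong (count (toℕ c)) e) (trans (tally-ʳ++ _ r h)
      (trans (+-comm (count (toℕ c) r) _) (count-word 0 l [] [] z≤n (toℕ<n c)))))
  ; lowerBound = proj₁ ∘ cells
  ; upperBound = proj₂ ∘ cells }) , e
  where
  r = lower 0 l []
  h = upper 0 l
  r< : All (_< n) r
  r< = lower-All 0 l [] (λ _ x<n → x<n) []
  h< : All (_< n) h
  h< = upper-< 0 l
  len : length (word l) ≡ 2 * n
  len = trans (length-ʳ++ r) (cong₂ _+_ (length-lower₀ l) (trans (length-upper 0 l) (sym (+-identityʳ n))))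
  v = proj₁ (fromLetters (word l) (ʳ++-All⁺ r< h<) len)
  e = proj₂ (fromLetters (word l) (ʳ++-All⁺ r< h<) len)
  below : RevPos (Cell n) r
  below = below⇒cell r (≤-reflexive (length-lower₀ l)) (subst (λ c → Stair (Below c) 1 r) (sym (length-lower₀ l)) (lower-stair 0 l [] tt))
  above : Pos (Cell n) (length r) h
  above = subst (λ i → Pos (Cell n) i h) (trans (+-identityʳ n) (sym (length-lower₀ l))) (above⇒cell 0 h h< (upper-stair 0 l))
  cells : ∀ i → Cell n (toℕ i) (toℕ (lookup v i))
  cells = pos-letters⁻ 0 v (subst (Pos (Cell n) 0) (sym e) (pos-ʳ++⁺ r h below above))

word-injective₀ : ∀ {n} (l l′ : Path 0 n) → word l ≡ word l′ → l ≡ l′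
word-injective₀ l l′ e
  with er , eh ← ʳ++-injective (lower 0 l []) (lower 0 l′ []) (trans (length-lower₀ l) (sym (length-lower₀ l′))) e
  = proj₁ (word-injective 0 l l′ [] [] refl refl eh er)

-- This is `energy` for a complete path, which starts with an empty stack and an empty word.
weight-inversions : ∀ {n} (l : Path 0 n) → weight l [] + inversions (word l) ≡ n C 2
weight-inversions {n} l = trans (trans (cong (weight l [] +_) (inversions-ʳ++ (lower 0 l []) (upper 0 l))) (shuffle (weight l []) _))
  (trans (energy 0 l [] [] [] refl) (triangle≡C n))
  where
  shuffle : ∀ w i → w + i ≡ i + w + 0
  shuffle = solve-∀

-- Dellac histories and paths, and the composite bijection

path⇒history : ∀ {n} (l : Path 0 n) → Σ (DH n) λ H → Hist l [] (proj₁ (proj₁ H)) (proj₂ (proj₁ H))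
path⇒history {n} l with s , ξ , h ← encode {M = n} l [] refl refl =
  ((s , ξ) , record
    { dyck   = record { nonneg = λ t _ → hist-nonneg h t ; ends = hist-ends h }
    ; blocks = λ j j<n → subst id (sym (blockCond≡ s ξ j)) (hist-cond h j j<n) }) , h

history⇒path : ∀ {n} (H : DH n) → Σ (Path 0 n) λ l → Hist l [] (proj₁ (proj₁ H)) (proj₂ (proj₁ H))
history⇒path {n} ((s , ξ) , isH)
  with hist-complete n {0} s ξ refl refl (IsDyck.ends (IsDellacHistory.dyck isH))
         (λ j j<n → subst id (blockCond≡ s ξ j) (IsDellacHistory.blocks isH j j<n))
... | l , [] , h = l , h

weightExp≡weight : ∀ {n} (H : DH n) {l : Path 0 n} → Hist l [] (proj₁ (proj₁ H)) (proj₂ (proj₁ H)) → weightExp H ≡ weight l []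
weightExp≡weight {n} ((s , ξ) , _) h =
  trans (cong sum (trans (map-upTo (blockExp s ξ) n) (applyUpTo-cong (blockExp≡ s ξ) n))) (hist-weight h)

theorem6 : (n : ℕ) → 1 ≤ n →
    Σ (DC n → DH n) (λ Φ →
    IsBijection Φ × ((D : DC n) → weightExp (Φ D) + inv D ≡ n C 2))
theorem6 n _ = Φ , (injective , surjective) , weighted
  where
  path : DC n → Path 0 n
  path (v , isD) = proj₁ (dellac⇒path v isD)

  word-path : ∀ D → letters (proj₁ D) ≡ word (path D)
  word-path (v , isD) = proj₂ (dellac⇒path v isD)

  Φ : DC n → DH n
  Φ D = proj₁ (path⇒history (path D))

  Φ-hist : ∀ D → Hist (path D) [] (proj₁ (proj₁ (Φ D))) (proj₂ (proj₁ (Φ D)))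
  Φ-hist D = proj₂ (path⇒history (path D))

  injective : ∀ D D′ → proj₁ (Φ D) ≡ proj₁ (Φ D′) → proj₁ D ≡ proj₁ D′
  injective D D′ e = letters-injective _ _ (trans (word-path D) (trans (cong word same) (sym (word-path D′))))
    where
    same : path D ≡ path D′
    same = proj₁ (hist-injective (Φ-hist D)
      (subst (λ H → Hist (path D′) [] (proj₁ H) (proj₂ H)) (sym e) (Φ-hist D′)))

  surjective : ∀ H → Σ (DC n) λ D → proj₁ (Φ D) ≡ proj₁ H
  surjective H with l , h ← history⇒path H with D , e ← path⇒dellac l
    -- `D` was built from `l`, and since its word determines the path, `path D` is `l` again.
    with same ← word-injective₀ (path D) l (trans (sym (word-path D)) e)
    with es , eξ ← hist-functional (Φ-hist D) (subst (λ l → Hist l [] _ _) (sym same) h)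
    = D , cong₂ _,_ es eξ

  weighted : ∀ D → weightExp (Φ D) + inv D ≡ n C 2
  weighted D = trans
    (cong₂ _+_ (weightExp≡weight (Φ D) (Φ-hist D)) (trans (invP-letters (proj₁ D)) (cong inversions (word-path D))))
    (weight-inversions (path D))
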